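{- For any given robber speed $R>2$ (an integer, or $R=\infty$), the following hold for all sufficiently large $n$. (i) If $R<\infty$, there exists a connected $n$-vertex graph on which at least $n^{1-\frac{1}{R-2}}$ cops are required to catch a robber of speed $R$. (ii) If $R=\infty$, there exists a connected $n$-vertex graph on which at least $\frac{n}{800^2}$ cops are required to catch a robber of speed $R=\infty$.
   Context: Graphs are finite and undirected. Cops and Robbers with a robber of speed $R$ on a graph $G$: a perfect information game between a set of cops and one robber. First the cops are placed on vertices of their choice (several cops may share a vertex); then the robber, knowing the cops' placement, chooses a vertex. Then the cops and the robber move in alternate rounds, the cops moving first. In a cops' move each cop stays put or moves along one edge. In the robber's move he may traverse any walk of at most $R$ edges starting at his current position (any finite walk if $R=\infty$; possibly staying put), but he is not allowed to pass through (or end at) any vertex occupied by a cop. The cops win if eventually a cop steps onto the vertex currently occupied by the robber; the robber wins if he can elude the cops indefinitely. "At least $x$ cops are required" means that no number of cops smaller than $x$ has a winning strategy. -}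

module Defs where

open import Data.Fin.Base using (Fin)
open import Data.List.Base using (List; []; _∷_)
open import Data.Nat.Base as ℕ using (ℕ; zero; suc)
open import Data.Product.Base using (_×_; ∃-syntax; Σ-syntax)
open import Level using (0ℓ)
open import Relation.Binary.Construct.Add.Supremum.NonStrict ℕ._≤_ using (_≤⁺_)
open import Relation.Binary.Construct.Closure.Reflexive using (ReflClosure)
open import Relation.Binary.Construct.Closure.ReflexiveTransitive using (Star)
open import Relation.Binary.Core using (Rel)
open import Relation.Binary.Definitions using (Decidable; Irreflexive; Symmetric)
open import Relation.Binary.PropositionalEquality.Core using (_≡_)
open import Relation.Nullary.Construct.Add.Supremum using (_⁺; [_])
open import Relation.Nullary.Negation.Core using (¬_)

record Graph (n : ℕ) : Set₁ where
  infix 4 _~_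
  field
    _~_      : Rel (Fin n) 0ℓ
    ~-sym    : Symmetric _~_
    ~-irrefl : Irreflexive _≡_ _~_
    _~?_     : Decidable _~_

Connected : ∀ {n} → Graph n → Set
Connected G = ∀ u v → Star (Graph._~_ G) u v

-- ⊤⁺ is the infinite speed.
Speed : Set
Speed = ℕ ⁺

module Game {n : ℕ} (G : Graph n) (R : Speed) (k : ℕ) where

  open Graph G

  Placement : Set
  Placement = Fin k → Fin n

  Occupied : Placement → Fin n → Set
  Occupied c v = ∃[ i ] c i ≡ v

  CopMove : Placement → Placement → Set
  CopMove c c′ = ∀ i → ReflClosure _~_ (c i) (c′ i)

  -- Walks of a given length, all of whose vertices after the first are free
  -- of cops.  The first vertex is where the robber already stands: it is free
  -- unless he has just been caught, and then his later moves do not matter.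
  -- Exempting it means that he always has a legal move, so every finite
  -- course of the game extends to an infinite play.
  data FreeWalk (c : Placement) : ℕ → Fin n → Fin n → Set where
    done : ∀ {u} → FreeWalk c zero u u
    step : ∀ {l u v w} → u ~ v → ¬ Occupied c v →
           FreeWalk c l v w → FreeWalk c (suc l) u w

  RobberMove : Placement → Fin n → Fin n → Set
  RobberMove c u w = ∃[ l ] ([ l ] ≤⁺ R × FreeWalk c l u w)

  -- The cops' placement as a function of the robber's past positions, most
  -- recent first.  The cops' own past is determined by these, so this is the
  -- full history of the game.
  record Strategy : Set where
    field
      place : List (Fin n) → Placement
      legal : ∀ r h → CopMove (place h) (place (r ∷ h))

  -- The robber's first t positions, most recent first.
  history : (ℕ → Fin n) → ℕ → List (Fin n)
  history ρ zero    = []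
  history ρ (suc t) = ρ t ∷ history ρ t

  -- The robber's position ρ t is followed by the cops' move to
  -- place (history ρ (suc t)), and then by his own move to ρ (suc t).
  module _ (σ : Strategy) (ρ : ℕ → Fin n) where
    open Strategy σ

    LegalPlay : Set
    LegalPlay = ∀ t → RobberMove (place (history ρ (suc t))) (ρ t) (ρ (suc t))

    -- Choosing an occupied vertex at the start is allowed, but the cop there
    -- may then catch the robber by staying put.
    Caught : Set
    Caught = ∃[ t ] Occupied (place (history ρ (suc t))) (ρ t)

  Winning : Strategy → Set
  Winning σ = ∀ ρ → LegalPlay σ ρ → Caught σ ρ

  CopsWin : Set
  CopsWin = Σ[ σ ∈ Strategy ] Winning σ

-- At least x cops are required, where the real number x is given by the
-- property of natural numbers k that k < x.
CopsRequired : ∀ {n} → Graph n → Speed → (ℕ → Set) → Set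
CopsRequired G R below = ∀ k → below k → ¬ Game.CopsWin G R k

-- k < n ^ (1 - 1/(r-2)) for r > 2: both sides raised to the power r - 2,
-- as 1 - 1/(r-2) = (r-3)/(r-2).
BelowPower : ℕ → ℕ → ℕ → Set
BelowPower r n k = k ℕ.^ (r ℕ.∸ 2) ℕ.< n ℕ.^ (r ℕ.∸ 3)

-- k < n / 800²
BelowFraction : ℕ → ℕ → Set
BelowFraction n k = k ℕ.* 800 ℕ.^ 2 ℕ.< n

{-# OPTIONS --safe #-}
module Submission where

-- The robber plays on a graph in which, whatever the cops' placement C, most
-- vertices v are good: from v, a large set of vertices can be reached by walks
-- within his speed that avoid the closed neighbourhood of C.  The cops'
-- next placement lies in that neighbourhood, so these walks remain free, and
-- one of them ends at a vertex that is good with respect to the new placement.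
--
-- For finite speed r the graph is the Hamming graph on [q]^r with
-- q^r ≤ n < (q+1)^r, blown up to n vertices.  Replacing the coordinates of v by
-- those of w one after the other gives a walk of length r, each vertex of which
-- is uniformly distributed when v and w are, so almost all of these walks avoid
-- the o(q^r) vertices threatened by the cops.
--
-- For infinite speed the graph is a path together with linearly many further
-- edges, of bounded degree, in which every two disjoint sets of at least n/5
-- vertices are joined by an edge.  The edges are found greedily, by averaging
-- over the 3-colourings of the vertices, whose first two colour classes
-- are the two sets.  After the removal of n/20 vertices, every set of n/4
-- vertices still meets a component of size n/4.

open import Defs
open import Data.Empty using (⊥)
open import Data.Fin.Base using (Fin; zero; suc; toℕ; fromℕ<; _↑ˡ_; splitAt)
import Data.Fin.Properties as Fin
open import Data.List.Base using (List; []; _∷_; _++_; map; length; allFin; cartesianProductWith)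
import Data.List.Base as List
open import Data.List.Membership.Propositional using (_∈_)
open import Data.List.Membership.Propositional.Properties using (∈-allFin; ∈-cartesianProductWith⁺)
open import Data.List.Properties using (map-++; map-∘; length-tabulate)
open import Data.List.Relation.Unary.All using (All; []; _∷_)
open import Data.List.Relation.Unary.AllPairs using ([]; _∷_)
open import Data.List.Relation.Unary.Any using (here; there; index)
open import Data.List.Relation.Unary.Any.Properties using (lookup-index)
open import Data.List.Relation.Unary.Unique.Propositional using (Unique)
open import Data.List.Relation.Unary.Unique.Propositional.Properties using (allFin⁺; cartesianProductWith⁺)
open import Data.Nat.Base using (ℕ; zero; suc; _+_; _*_; _∸_; _^_; _≤_; _<_; z≤n; s≤s; s≤s⁻¹; >-nonZero)
open import Data.Nat.ListAction using (sum)
open import Data.Nat.ListAction.Properties using (sum-++)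
open import Data.Nat.Properties
open import Data.Nat.Tactic.RingSolver using (solve-∀)
open import Data.Product.Base using (_×_; _,_; proj₁; proj₂; map₂; ∃-syntax; Σ-syntax)
open import Data.Sum.Base using ([_,_]′; _⊎_; inj₁; inj₂)
open import Data.Unit.Base using (⊤; tt)
open import Data.Vec.Base using (Vec; []; _∷_; replicate; lookup; tabulate)
open import Data.Vec.Properties using (∷-injective)
import Data.Vec.Properties as Vec
open import Function.Base using (_∘_; _$_; id; const)
import Relation.Binary.Construct.Closure.Reflexive as Reflexive
open Reflexive using (ReflClosure)
open import Relation.Binary.Construct.Closure.ReflexiveTransitive using (Star; ε; _◅_)
open import Level using (0ℓ)
open import Relation.Binary.Core using (Rel)
import Relation.Binary.Definitions as B
open import Relation.Binary.PropositionalEquality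
open import Relation.Nullary.Decidable.Core using (Dec; yes; no; ¬?; _×-dec_)
open import Relation.Nullary.Negation.Core using (¬_; contradiction)
open import Relation.Unary using (Decidable; _∪_)
open import Relation.Unary.Properties using (_∪?_)
open import Relation.Binary.Construct.Add.Supremum.NonStrict _≤_ using (_≤⁺_; [_]; _≤⊤⁺; ≤⁺-trans)
open import Relation.Binary.Construct.Add.Supremum.Strict _<_ using (_<⁺_; [_]; [_]<⊤⁺)
open import Relation.Nullary.Construct.Add.Supremum using ([_]; ⊤⁺)

-- Finite sums over lists, averaging, and indicators.

private variable
  A B C : Set
  P Q : Set

∑ : List A → (A → ℕ) → ℕ
∑ xs f = sum (map f xs)

syntax ∑ xs (λ x → e) = ∑[ x ∈ xs ] e
infix 10 ∑

∑-mono : ∀ (xs : List A) {f g} → (∀ x → f x ≤ g x) → ∑ xs f ≤ ∑ xs g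
∑-mono []       f≤g = z≤n
∑-mono (x ∷ xs) f≤g = +-mono-≤ (f≤g x) (∑-mono xs f≤g)

∑-cong : ∀ (xs : List A) {f g} → (∀ x → f x ≡ g x) → ∑ xs f ≡ ∑ xs g
∑-cong []       f≡g = refl
∑-cong (x ∷ xs) f≡g = cong₂ _+_ (f≡g x) (∑-cong xs f≡g)

∑-+ : ∀ (xs : List A) f g → ∑[ x ∈ xs ] (f x + g x) ≡ ∑ xs f + ∑ xs g
∑-+ []       f g = refl
∑-+ (x ∷ xs) f g = trans (cong (f x + g x +_) (∑-+ xs f g)) (interchange (f x) (g x) _ _)
  where
  interchange : ∀ a b c d → a + b + (c + d) ≡ a + c + (b + d)
  interchange = solve-∀

∑-*ˡ : ∀ (xs : List A) c f → ∑[ x ∈ xs ] (c * f x) ≡ c * ∑ xs f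
∑-*ˡ []       c f = sym (*-zeroʳ c)
∑-*ˡ (x ∷ xs) c f = trans (cong (c * f x +_) (∑-*ˡ xs c f)) (sym (*-distribˡ-+ c (f x) _))

∑-*ʳ : ∀ (xs : List A) c f → ∑[ x ∈ xs ] (f x * c) ≡ ∑ xs f * c
∑-*ʳ xs c f = trans (∑-cong xs λ x → *-comm (f x) c) (trans (∑-*ˡ xs c f) (*-comm c _))

∑-const : ∀ (xs : List A) c → ∑[ _ ∈ xs ] c ≡ length xs * c
∑-const []       c = refl
∑-const (x ∷ xs) c = cong (c +_) (∑-const xs c)

∑-bound : ∀ (xs : List A) {c f} → (∀ x → f x ≤ c) → ∑ xs f ≤ length xs * c
∑-bound xs f≤c = ≤-trans (∑-mono xs f≤c) (≤-reflexive (∑-const xs _))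

∑-swap : ∀ (xs : List A) (ys : List B) (f : A → B → ℕ) →
         ∑[ x ∈ xs ] ∑[ y ∈ ys ] f x y ≡ ∑[ y ∈ ys ] ∑[ x ∈ xs ] f x y
∑-swap []       ys f = sym (trans (∑-const ys 0) (*-zeroʳ (length ys)))
∑-swap (x ∷ xs) ys f =
  trans (cong (∑ ys (f x) +_) (∑-swap xs ys f)) (sym (∑-+ ys (f x) _))

∑-product : ∀ (xs : List A) (ys : List B) (f : A → ℕ) (g : B → ℕ) →
            ∑[ x ∈ xs ] ∑[ y ∈ ys ] (f x * g y) ≡ ∑ xs f * ∑ ys g
∑-product xs ys f g = trans (∑-cong xs λ x → ∑-*ˡ ys (f x) g) (∑-*ʳ xs (∑ ys g) f)

∑-∈ : ∀ {xs : List A} {x} f → x ∈ xs → f x ≤ ∑ xs f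
∑-∈ f (here refl) = m≤m+n _ _
∑-∈ f (there x∈)  = ≤-trans (∑-∈ f x∈) (m≤n+m _ _)

∑-mono-< : ∀ {xs : List A} {x} {f g} → x ∈ xs → (∀ y → f y ≤ g y) → f x < g x →
           ∑ xs f < ∑ xs g
∑-mono-< {xs = _ ∷ xs} (here refl) f≤g fx<gx = +-mono-<-≤ fx<gx (∑-mono xs f≤g)
∑-mono-< {xs = y ∷ _}  (there x∈)  f≤g fx<gx = +-mono-≤-< (f≤g y) (∑-mono-< x∈ f≤g fx<gx)

-- The averaging principle. The choices of vertices and edges below are all made by comparing two
-- sums.
∑-<⇒∃ : ∀ (xs : List A) {f g} → ∑ xs f < ∑ xs g → ∃[ x ] f x < g x
∑-<⇒∃ (x ∷ xs) {f} {g} lt with f x <? g x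
... | yes fx<gx = x , fx<gx
... | no  fx≮gx = ∑-<⇒∃ xs (≰⇒> λ ge → <⇒≱ lt (+-mono-≤ (≮⇒≥ fx≮gx) ge))

∑-≤⇒∃ : ∀ (xs : List A) {f g} → 0 < length xs → ∑ xs f ≤ ∑ xs g → ∃[ x ] f x ≤ g x
∑-≤⇒∃ xs@(_ ∷ _) {f} {g} _ le = map₂ s≤s⁻¹ (∑-<⇒∃ xs strict)
  where
  -- Raising each `g x` by one makes the inequality strict, as the list is nonempty, and `s≤s⁻¹`
  -- undoes it.
  strict : ∑ xs f < ∑ xs (suc ∘ g)
  strict = begin-strict
    ∑ xs f                  ≤⟨ le ⟩
    ∑ xs g                  <⟨ m<n+m (∑ xs g) {length xs * 1} (s≤s z≤n) ⟩
    length xs * 1 + ∑ xs g  ≡⟨ cong (_+ ∑ xs g) (∑-const xs 1) ⟨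
    ∑ xs (λ _ → 1) + ∑ xs g ≡⟨ ∑-+ xs (λ _ → 1) g ⟨
    ∑ xs (suc ∘ g)          ∎
    where open ≤-Reasoning

∑-pos⇒∃ : ∀ (xs : List A) {f} → 0 < ∑ xs f → ∃[ x ] 0 < f x
∑-pos⇒∃ xs {f} pos = ∑-<⇒∃ xs (subst (_< ∑ xs f) (sym (trans (∑-const xs 0) (*-zeroʳ (length xs)))) pos)

∑-cartesianProductWith : ∀ (h : A → B → C) xs ys f →
  ∑ (cartesianProductWith h xs ys) f ≡ ∑[ x ∈ xs ] ∑[ y ∈ ys ] f (h x y)
∑-cartesianProductWith h []       ys f = refl
∑-cartesianProductWith h (x ∷ xs) ys f = begin
  sum (map f (map (h x) ys ++ rest))        ≡⟨ cong sum (map-++ f (map (h x) ys) rest) ⟩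
  sum (map f (map (h x) ys) ++ map f rest)  ≡⟨ sum-++ (map f (map (h x) ys)) _ ⟩
  sum (map f (map (h x) ys)) + ∑ rest f     ≡⟨ cong₂ _+_ (cong sum (sym (map-∘ ys)))
                                                 (∑-cartesianProductWith h xs ys f) ⟩
  _                                         ∎
  where
  open ≡-Reasoning
  rest = cartesianProductWith h xs ys

⟦_⟧ : Dec P → ℕ
⟦ yes _ ⟧ = 1
⟦ no  _ ⟧ = 0

⟦⟧-yes : (P? : Dec P) → P → ⟦ P? ⟧ ≡ 1
⟦⟧-yes (yes _) p = refl
⟦⟧-yes (no ¬p) p = contradiction p ¬p

⟦⟧-no : (P? : Dec P) → ¬ P → ⟦ P? ⟧ ≡ 0
⟦⟧-no (yes p) ¬p = contradiction p ¬p
⟦⟧-no (no _)  ¬p = refl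

⟦⟧≤1 : (P? : Dec P) → ⟦ P? ⟧ ≤ 1
⟦⟧≤1 (yes _) = s≤s z≤n
⟦⟧≤1 (no _)  = z≤n

⟦⟧-mono : (P? : Dec P) (Q? : Dec Q) → (P → Q) → ⟦ P? ⟧ ≤ ⟦ Q? ⟧
⟦⟧-mono (yes p) Q? p⇒q = ≤-reflexive (sym (⟦⟧-yes Q? (p⇒q p)))
⟦⟧-mono (no _)  Q? p⇒q = z≤n

⟦⟧-pos : (P? : Dec P) → 0 < ⟦ P? ⟧ → P
⟦⟧-pos (yes p) _ = p

∑-⟦⟧-unique : ∀ {P : A → Set} {xs : List A} → Unique xs → (P? : Decidable P) →
              (∀ {x y} → P x → P y → x ≡ y) → ∑[ x ∈ xs ] ⟦ P? x ⟧ ≤ 1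
∑-⟦⟧-unique []         P? inj = z≤n
∑-⟦⟧-unique {P = P} {x ∷ xs} (x∉ ∷ u) P? inj with P? x
... | no  _  = ∑-⟦⟧-unique u P? inj
... | yes px = s≤s (none x∉)
  where
  none : ∀ {ys} → All (x ≢_) ys → ∑[ y ∈ ys ] ⟦ P? y ⟧ ≤ 0
  none []         = z≤n
  none {y ∷ _} (x≢y ∷ x≢) rewrite ⟦⟧-no (P? y) (λ py → x≢y (inj px py)) = none x≢

-- Enumeration of the words over a finite alphabet.

vectors : ∀ q r → List (Vec (Fin q) r)
vectors q zero    = [] ∷ []
vectors q (suc r) = cartesianProductWith _∷_ (allFin q) (vectors q r)

∑-vectors : ∀ q r f → ∑ (vectors q (suc r)) f ≡ ∑[ a ∈ allFin q ] ∑[ v ∈ vectors q r ] f (a ∷ v)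
∑-vectors q r = ∑-cartesianProductWith _∷_ (allFin q) (vectors q r)

∈-vectors : ∀ {q r} (v : Vec (Fin q) r) → v ∈ vectors q r
∈-vectors []      = here refl
∈-vectors (a ∷ v) = ∈-cartesianProductWith⁺ _∷_ (∈-allFin a) (∈-vectors v)

vectors-unique : ∀ q r → Unique (vectors q r)
vectors-unique q zero    = [] ∷ []
vectors-unique q (suc r) =
  cartesianProductWith⁺ _∷_ ∷-injective (allFin⁺ q) (vectors-unique q r)

length-allFin : ∀ n → length (allFin n) ≡ n
length-allFin n = length-tabulate _

length-vectors : ∀ q r → length (vectors q r) ≡ q ^ r
length-vectors q zero    = refl
length-vectors q (suc r) = begin
  length (vectors q (suc r))          ≡⟨ *-identityʳ _ ⟨
  length (vectors q (suc r)) * 1      ≡⟨ ∑-const (vectors q (suc r)) 1 ⟨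
  ∑ (vectors q (suc r)) (λ _ → 1)     ≡⟨ ∑-vectors q r (λ _ → 1) ⟩
  ∑ (allFin q) (λ _ → ∑ (vectors q r) (λ _ → 1)) ≡⟨ ∑-const (allFin q) _ ⟩
  length (allFin q) * ∑ (vectors q r) (λ _ → 1)
    ≡⟨ cong₂ _*_ (length-allFin q) (trans (∑-const (vectors q r) 1) (*-identityʳ _)) ⟩
  q * length (vectors q r)            ≡⟨ cong (q *_) (length-vectors q r) ⟩
  q ^ suc r                           ∎
  where open ≡-Reasoning

∑-allFin-const : ∀ n c → ∑[ _ ∈ allFin n ] c ≡ n * c
∑-allFin-const n c = trans (∑-const (allFin n) c) (cong (_* c) (length-allFin n))

^-distribʳ-* : ∀ m a b → (a * b) ^ m ≡ a ^ m * b ^ m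
^-distribʳ-* zero    a b = refl
^-distribʳ-* (suc m) a b = trans (cong (a * b *_) (^-distribʳ-* m a b)) (rearrange a b (a ^ m) (b ^ m))
  where
  rearrange : ∀ a b c d → a * b * (c * d) ≡ a * c * (b * d)
  rearrange = solve-∀

-- Walks, and evasion on a blown-up reflexive graph.

data Walk {V : Set} (_≈_ : Rel V 0ℓ) (Free : V → Set) : ℕ → V → V → Set where
  done : ∀ {u} → Walk _≈_ Free zero u u
  step : ∀ {l u v w} → u ≈ v → Free v → Walk _≈_ Free l v w → Walk _≈_ Free (suc l) u w

module _ {V : Set} {_≈_ : Rel V 0ℓ} {Free : V → Set} where

  snoc : ∀ {l u v w} → Walk _≈_ Free l u v → v ≈ w → Free w → Walk _≈_ Free (suc l) u w
  snoc done          v≈w free = step v≈w free done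
  snoc (step e f ws) v≈w free = step e f (snoc ws v≈w free)

walk-map : ∀ {V W : Set} {_≈_ : Rel V 0ℓ} {_≈′_ : Rel W 0ℓ} {F : V → Set} {F′ : W → Set}
           (g : V → W) → (∀ {u v} → u ≈ v → g u ≈′ g v) → (∀ {v} → F v → F′ (g v)) →
           ∀ {l u v} → Walk _≈_ F l u v → Walk _≈′_ F′ l (g u) (g v)
walk-map g hom free done          = done
walk-map g hom free (step e f ws) = step (hom e) (free f) (walk-map g hom free ws)

-- The blow-up of a reflexive graph (V, Close) along f, where vertices of a
-- common fibre are adjacent.  A robber who stays on the section s only meets
-- cops whose projection to V is his own, so the game may be played on V.
module Blowup
  {n : ℕ} {V : Set}
  (Close : Rel V 0ℓ) (close-refl : ∀ {v} → Close v v)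
  (close-sym : ∀ {u v} → Close u v → Close v u) (close? : B.Decidable Close)
  (f : Fin n → V) (s : V → Fin n) (f∘s : ∀ v → f (s v) ≡ v)
  where

  graph : Graph n
  graph = record
    { _~_      = λ u v → u ≢ v × Close (f u) (f v)
    ; ~-sym    = λ (u≢v , c) → u≢v ∘ sym , close-sym c
    ; ~-irrefl = λ u≡v (u≢v , _) → u≢v u≡v
    ; _~?_     = λ u v → ¬? (u Fin.≟ v) ×-dec close? (f u) (f v)
    }

  open Graph graph

  lift-close : ∀ {u v} → Close (f u) v → Close (f u) (f (s v))
  lift-close {u} {v} = subst (Close (f u)) (sym (f∘s v))

  -- The walk is lifted along `s`; its last step joins a lift of `f v` to `v` inside a fibre, where
  -- reflexivity of `Close` gives the edge.
  connected : (∀ u v → ∃[ l ] Walk Close (λ _ → ⊤) l u v) → Connected graph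
  connected walk u v = star (proj₂ (walk (f u) (f v))) refl refl
    where
    close⇒star : ∀ {u v w} → Close (f u) (f v) → Star _~_ v w → Star _~_ u w
    close⇒star {u} {v} c vs with u Fin.≟ v
    ... | yes refl = vs
    ... | no  u≢v  = (u≢v , c) ◅ vs

    star : ∀ {l x y u v} → Walk Close (λ _ → ⊤) l x y → f u ≡ x → f v ≡ y → Star _~_ u v
    star {u = u} done refl p = close⇒star (subst (Close (f u)) (sym p) close-refl) ε
    star (step {v = x} c _ ws) refl q = close⇒star (lift-close c) (star ws (f∘s x) q)

  module _ (R : Speed) (k : ℕ) where

    open Game graph R k

    Unthreatened : (Fin k → V) → V → Set
    Unthreatened C v = ∀ i → ¬ Close (C i) v

    module _ {ℓ}
      (Good : (Fin k → V) → V → Set ℓ)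
      (good⇒unthreatened : ∀ {C v} → Good C v → Unthreatened C v)
      (start : ∀ C → ∃[ v ] Good C v)
      (advance : ∀ {C v} C′ → Good C v → ∃[ w ] (Good C′ w ×
                 ∃[ l ] ([ l ] ≤⁺ R × Walk Close (Unthreatened C) l v w)))
      where

      copMove⇒close : ∀ {c c′} → CopMove c c′ → ∀ i → Close (f (c i)) (f (c′ i))
      copMove⇒close {c} {c′} move i = go (move i)
        where
        go : ∀ {u v} → ReflClosure _~_ u v → Close (f u) (f v)
        go Reflexive.refl        = close-refl
        go Reflexive.[ (_ , c) ] = c

      -- A cop standing on `s v` after the move projects to `v`, so its projection before the move
      -- was close to `v`.
      unthreatened⇒free : ∀ {c c′ v} → CopMove c c′ → Unthreatened (f ∘ c) v → ¬ Occupied c′ (s v)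
      unthreatened⇒free {c} {v = v} move unthreatened (i , c′i≡sv) =
        unthreatened i (subst (Close (f (c i))) (trans (cong f c′i≡sv) (f∘s v)) (copMove⇒close move i))

      -- `Close` is reflexive but `_~_` is not: a step that stays in place under `s` is dropped, so
      -- the length may decrease.
      freeWalk : ∀ {c c′ l u v} → CopMove c c′ → Walk Close (Unthreatened (f ∘ c)) l u v →
                 ∃[ l′ ] (l′ ≤ l × FreeWalk c′ l′ (s u) (s v))
      freeWalk move done = 0 , z≤n , done
      freeWalk {c′ = c′} {u = u} {w} move (step {v = x} e free ws) with freeWalk move ws | s u Fin.≟ s x
      ... | l′ , l′≤l , ws′ | yes su≡sx =
        l′ , m≤n⇒m≤1+n l′≤l , subst (λ z → FreeWalk c′ l′ z (s w)) (sym su≡sx) ws′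
      ... | l′ , l′≤l , ws′ | no  su≢sx =
        suc l′ , s≤s l′≤l ,
        step (su≢sx , subst₂ Close (sym (f∘s u)) (sym (f∘s x)) e) (unthreatened⇒free move free) ws′

      -- The invariant: the robber's vertex is good for the placement before the cops' move. Their
      -- reply to `s v` is determined by `σ`, so `advance` may look at it in choosing his next
      -- vertex.
      robberEvades : ¬ CopsWin
      robberEvades (σ , winning) = escaped (winning ρ legalPlay)
        where
        open Strategy σ

        State : Set ℓ
        State = ∃[ h ] ∃[ v ] Good (f ∘ place h) v

        next : State → State
        next (h , v , good) with w , good′ , _ ← advance (f ∘ place (s v ∷ h)) good =
          s v ∷ h , w , good′

        state : ℕ → State
        state zero    = [] , start (f ∘ place [])
        state (suc t) = next (state t)

        hist : ℕ → List (Fin n)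
        hist t = proj₁ (state t)

        ρ : ℕ → Fin n
        ρ t = s (proj₁ (proj₂ (state t)))

        history-ρ : ∀ t → history ρ t ≡ hist t
        history-ρ zero    = refl
        history-ρ (suc t) = cong (ρ t ∷_) (history-ρ t)

        legalPlay : LegalPlay σ ρ
        legalPlay t rewrite history-ρ t
          with h , v , good ← state t
          with w , _ , l , l≤R , ws ← advance (f ∘ place (s v ∷ h)) good
          with l′ , l′≤l , ws′ ← freeWalk (legal (s v) h) ws =
          l′ , ≤⁺-trans ≤-trans [ l′≤l ] l≤R , ws′

        escaped : ¬ Caught σ ρ
        escaped (t , caught) rewrite history-ρ t
          with h , v , good ← state t =
          unthreatened⇒free (legal (s v) h) (good⇒unthreatened good) caught

⟦⟧-cong : ∀ {P Q : Set} (P? : Dec P) (Q? : Dec Q) → (P → Q) → (Q → P) → ⟦ P? ⟧ ≡ ⟦ Q? ⟧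
⟦⟧-cong P? Q? to from = ≤-antisym (⟦⟧-mono P? Q? to) (⟦⟧-mono Q? P? from)

0≮n⇒n≡0 : ∀ {n} → ¬ 0 < n → n ≡ 0
0≮n⇒n≡0 0≮n = n≤0⇒n≡0 (≮⇒≥ 0≮n)

m*n<m⇒n≡0 : ∀ {m n} → m * n < m → n ≡ 0
m*n<m⇒n≡0 {m} {zero}  _  = refl
m*n<m⇒n≡0 {m} {suc n} lt = contradiction lt (≤⇒≯ (m≤m*n m (suc n)))

-- Allows a graph on `V` to be blown up to exactly `n` vertices: all the surplus joins the fibre of
-- `default`.
retraction : ∀ {V : Set} (xs : List V) → (∀ v → v ∈ xs) → V → ∀ {n} → length xs ≤ n →
             Σ[ f ∈ (Fin n → V) ] Σ[ s ∈ (V → Fin n) ] (∀ v → f (s v) ≡ v)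
retraction {V} xs complete default {n} len≤n
  with m , refl ← m≤n⇒∃[o]m+o≡n len≤n = f , s , f∘s
  where
  f : Fin (length xs + m) → V
  f i = [ List.lookup xs , const default ]′ (splitAt (length xs) i)

  s : V → Fin (length xs + m)
  s v = index (complete v) ↑ˡ m

  f∘s : ∀ v → f (s v) ≡ v
  f∘s v rewrite Fin.splitAt-↑ˡ (length xs) (index (complete v)) m =
    sym (lookup-index (complete v))

-- The Hamming graph and its coordinate-replacing paths.

module Hamming {q : ℕ} where

  private variable r : ℕ

  _≟ᵛ_ : (u v : Vec (Fin q) r) → Dec (u ≡ v)
  _≟ᵛ_ = Vec.≡-dec Fin._≟_

  -- Positive if and only if u and v differ in at most one coordinate.
  weight : Vec (Fin q) r → Vec (Fin q) r → ℕ
  weight []      []      = 1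
  weight (a ∷ u) (b ∷ v) = ⟦ a Fin.≟ b ⟧ * weight u v + ⟦ u ≟ᵛ v ⟧

  Close : Vec (Fin q) r → Vec (Fin q) r → Set
  Close u v = 0 < weight u v

  weight-sym : (u v : Vec (Fin q) r) → weight u v ≡ weight v u
  weight-sym []      []      = refl
  weight-sym (a ∷ u) (b ∷ v) =
    cong₂ _+_ (cong₂ _*_ (⟦⟧-cong (a Fin.≟ b) (b Fin.≟ a) sym sym) (weight-sym u v))
              (⟦⟧-cong (u ≟ᵛ v) (v ≟ᵛ u) sym sym)

  close-replace : ∀ a b (u : Vec (Fin q) r) → Close (a ∷ u) (b ∷ u)
  close-replace a b u = ≤-trans (≤-reflexive (sym (⟦⟧-yes (u ≟ᵛ u) refl))) (m≤n+m _ _)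

  close-∷ : ∀ a {u v : Vec (Fin q) r} → Close u v → Close (a ∷ u) (a ∷ v)
  close-∷ a {u} {v} c rewrite ⟦⟧-yes (a Fin.≟ a) refl | +-identityʳ (weight u v) =
    ≤-trans c (m≤m+n _ _)

  close-refl : ∀ {v : Vec (Fin q) r} → Close v v
  close-refl {v = []}    = s≤s z≤n
  close-refl {v = a ∷ v} = close-replace a a v

  -- Either the first coordinates agree, and induction applies, or the remaining ones do, leaving
  -- `q` choices of the first. The word `u` itself is counted repeatedly, hence `r * q` and not
  -- `r * (q - 1)`.
  ∑-weight : (u : Vec (Fin q) r) → ∑ (vectors q r) (weight u) ≤ 1 + r * q
  ∑-weight []              = ≤-refl
  ∑-weight {suc r} (a ∷ u) = begin
    ∑ (vectors q (suc r)) (weight (a ∷ u))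
      ≡⟨ ∑-vectors q r (weight (a ∷ u)) ⟩
    ∑[ b ∈ allFin q ] ∑[ v ∈ vs ] (⟦ a Fin.≟ b ⟧ * weight u v + ⟦ u ≟ᵛ v ⟧)
      ≡⟨ ∑-cong (allFin q) (λ b → ∑-+ vs _ _) ⟩
    ∑[ b ∈ allFin q ] (∑[ v ∈ vs ] (⟦ a Fin.≟ b ⟧ * weight u v) + equal)
      ≡⟨ ∑-+ (allFin q) _ _ ⟩
    ∑[ b ∈ allFin q ] ∑[ v ∈ vs ] (⟦ a Fin.≟ b ⟧ * weight u v) + ∑[ b ∈ allFin q ] equal
      ≡⟨ cong₂ _+_ (∑-product (allFin q) vs _ _) (∑-allFin-const q equal) ⟩
    ∑[ b ∈ allFin q ] ⟦ a Fin.≟ b ⟧ * ∑ vs (weight u) + q * equal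
      ≤⟨ +-mono-≤ (*-mono-≤ (∑-⟦⟧-unique (allFin⁺ q) (a Fin.≟_) λ p p′ → trans (sym p) p′)
                            (∑-weight u))
                  (*-monoʳ-≤ q (∑-⟦⟧-unique (vectors-unique q r) (u ≟ᵛ_) λ p p′ → trans (sym p) p′)) ⟩
    1 * (1 + r * q) + q * 1
      ≡⟨ rearrange q r ⟩
    1 + suc r * q ∎
    where
    open ≤-Reasoning
    vs    = vectors q r
    equal = ∑[ v ∈ vs ] ⟦ u ≟ᵛ v ⟧
    rearrange : ∀ q r → 1 * (1 + r * q) + q * 1 ≡ 1 + suc r * q
    rearrange = solve-∀

  -- The sum of x over the path from v to w that replaces one coordinate after
  -- the other.
  pathCost : (Vec (Fin q) r → ℕ) → Vec (Fin q) r → Vec (Fin q) r → ℕ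
  pathCost x []      []      = x []
  pathCost x (a ∷ v) (b ∷ w) = x (a ∷ v) + pathCost (x ∘ (b ∷_)) v w

  x≤pathCost : ∀ x (v w : Vec (Fin q) r) → x v ≤ pathCost x v w
  x≤pathCost x []      []      = ≤-refl
  x≤pathCost x (a ∷ v) (b ∷ w) = m≤m+n _ _

  path : ∀ x (v w : Vec (Fin q) r) → pathCost x v w ≡ 0 → Walk Close (λ u → x u ≡ 0) r v w
  path x []      []      _  = done
  path x (a ∷ v) (b ∷ w) eq =
    step (close-replace a b v)
         -- The next vertex `b ∷ v` starts the remaining path, so its term is at most the remaining
         -- cost.
         (n≤0⇒n≡0 (≤-trans (x≤pathCost (x ∘ (b ∷_)) v w) (≤-reflexive cost≡0)))
         (walk-map (b ∷_) (close-∷ b) id (path (x ∘ (b ∷_)) v w cost≡0))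
    where
    cost≡0 : pathCost (x ∘ (b ∷_)) v w ≡ 0
    cost≡0 = m+n≡0⇒n≡0 (x (a ∷ v)) eq

  -- Every vertex of the path from v to w is uniformly distributed when v and
  -- w are.
  ∑-pathCost : ∀ (x : Vec (Fin q) r → ℕ) →
    ∑[ v ∈ vectors q r ] ∑[ w ∈ vectors q r ] pathCost x v w ≡ suc r * (q ^ r * ∑ (vectors q r) x)
  ∑-pathCost {zero}  x = rearrange (x [])
    where
    rearrange : ∀ c → c + 0 + 0 ≡ 1 * (1 * (c + 0))
    rearrange = solve-∀
  ∑-pathCost {suc r} x = begin
    ∑[ v ∈ vectors q (suc r) ] ∑[ w ∈ vectors q (suc r) ] pathCost x v w
      ≡⟨ ∑-vectors q r _ ⟩
    ∑[ a ∈ as ] ∑[ v ∈ vs ] ∑[ w ∈ vectors q (suc r) ] pathCost x (a ∷ v) w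
      ≡⟨ (∑-cong as λ a → ∑-cong vs λ v → inner a v) ⟩
    ∑[ a ∈ as ] ∑[ v ∈ vs ] (q ^ suc r * x (a ∷ v) + tail v)
      ≡⟨ (∑-cong as λ a → trans (∑-+ vs _ _) (cong (_+ ∑ vs tail) (∑-*ˡ vs (q ^ suc r) _))) ⟩
    ∑[ a ∈ as ] (q ^ suc r * ∑[ v ∈ vs ] x (a ∷ v) + ∑ vs tail)
      ≡⟨ trans (∑-+ as _ _) (cong₂ _+_ (∑-*ˡ as (q ^ suc r) _) (∑-allFin-const q _)) ⟩
    q ^ suc r * (∑[ a ∈ as ] ∑[ v ∈ vs ] x (a ∷ v)) + q * ∑ vs tail
      ≡⟨ cong₂ (λ s t → q ^ suc r * s + q * t) (sym (∑-vectors q r x)) tails ⟩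
    q ^ suc r * X + q * (suc r * (q ^ r * X))
      ≡⟨ rearrange q (q ^ r) X r ⟩
    suc (suc r) * (q ^ suc r * X) ∎
    where
    open ≡-Reasoning
    as = allFin q
    vs = vectors q r
    X  = ∑ (vectors q (suc r)) x

    -- The cost once the first coordinate has been replaced. It does not depend on `a`, so summing
    -- over `a` gives a factor `q`.
    tail : Vec (Fin q) r → ℕ
    tail v = ∑[ b ∈ as ] ∑[ w ∈ vs ] pathCost (x ∘ (b ∷_)) v w

    inner : ∀ a v → ∑[ w ∈ vectors q (suc r) ] pathCost x (a ∷ v) w ≡ q ^ suc r * x (a ∷ v) + tail v
    inner a v = begin
      ∑[ w ∈ vectors q (suc r) ] pathCost x (a ∷ v) w
        ≡⟨ ∑-vectors q r _ ⟩
      ∑[ b ∈ as ] ∑[ w ∈ vs ] (x (a ∷ v) + pathCost (x ∘ (b ∷_)) v w)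
        ≡⟨ trans (∑-cong as λ b → ∑-+ vs _ _) (∑-+ as _ _) ⟩
      ∑[ b ∈ as ] ∑[ w ∈ vs ] x (a ∷ v) + tail v
        ≡⟨ cong (_+ tail v) (trans (sym (∑-vectors q r (λ _ → x (a ∷ v)))) (trans (∑-const (vectors q (suc r)) _)
             (cong (_* x (a ∷ v)) (length-vectors q (suc r))))) ⟩
      q ^ suc r * x (a ∷ v) + tail v ∎

    tails : ∑ vs tail ≡ suc r * (q ^ r * X)
    tails = begin
      ∑ vs tail
        ≡⟨ ∑-swap vs as _ ⟩
      ∑[ b ∈ as ] ∑[ v ∈ vs ] ∑[ w ∈ vs ] pathCost (x ∘ (b ∷_)) v w
        ≡⟨ ∑-cong as (λ b → ∑-pathCost (x ∘ (b ∷_))) ⟩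
      ∑[ b ∈ as ] (suc r * (q ^ r * ∑[ v ∈ vs ] x (b ∷ v)))
        ≡⟨ trans (∑-*ˡ as (suc r) _) (cong (suc r *_) (∑-*ˡ as (q ^ r) _)) ⟩
      suc r * (q ^ r * (∑[ b ∈ as ] ∑[ v ∈ vs ] x (b ∷ v)))
        ≡⟨ cong (λ s → suc r * (q ^ r * s)) (∑-vectors q r x) ⟨
      suc r * (q ^ r * X) ∎

    rearrange : ∀ q Q X r → q * Q * X + q * (suc r * (Q * X)) ≡ suc (suc r) * (q * Q * X)
    rearrange = solve-∀

  -- Evasion at finite speed.

  module Evasion {r n : ℕ} (q>0 : 0 < q) (q^r≤n : q ^ r ≤ n) where

    V : Set
    V = Vec (Fin q) r

    vs : List V
    vs = vectors q r

    N : ℕ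
    N = q ^ r

    ∑-constᴺ : ∀ c → ∑[ _ ∈ vs ] c ≡ N * c
    ∑-constᴺ c = trans (∑-const vs c) (cong (_* c) (length-vectors q r))

    N>0 : 0 < N
    N>0 = m^n>0 q {{>-nonZero q>0}} r

    blowup : Σ[ f ∈ (Fin n → V) ] Σ[ s ∈ (V → Fin n) ] (∀ v → f (s v) ≡ v)
    blowup = retraction vs ∈-vectors (replicate r (fromℕ< q>0))
                       (subst (_≤ n) (sym (length-vectors q r)) q^r≤n)

    open Blowup {n} {V} Close (λ {v} → close-refl {v = v}) (λ {u} {v} → subst (0 <_) (weight-sym u v))
      (λ u v → 0 <? weight u v) (proj₁ blowup) (proj₁ (proj₂ blowup)) (proj₂ (proj₂ blowup)) public

    graph-connected : Connected graph
    graph-connected = connected λ u v → r , walk-map id id (λ _ → tt) (path (λ _ → 0) u v (zeroCost u v))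
      where
      zeroCost : ∀ {r} (u v : Vec (Fin q) r) → pathCost (λ _ → 0) u v ≡ 0
      zeroCost []      []      = refl
      zeroCost (_ ∷ u) (_ ∷ v) = zeroCost u v

    module _ {k : ℕ} (few : 4 * (suc r * (k * (1 + r * q))) ≤ N) where

      threat : (Fin k → V) → V → ℕ
      threat C v = ∑[ j ∈ allFin k ] weight (C j) v

      unthreatened : ∀ C v → threat C v ≡ 0 → Unthreatened [ r ] k C v
      unthreatened C v eq i close =
        <⇒≱ close (subst (weight (C i) v ≤_) eq (∑-∈ (λ j → weight (C j) v) (∈-allFin i)))

      ∑-threat : ∀ C → ∑ vs (threat C) ≤ k * (1 + r * q)
      ∑-threat C = begin
        ∑ vs (threat C)                            ≡⟨ ∑-swap vs (allFin k) _ ⟩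
        ∑[ j ∈ allFin k ] ∑[ v ∈ vs ] weight (C j) v ≤⟨ ∑-bound (allFin k) (λ j → ∑-weight (C j)) ⟩
        _                                          ≡⟨ cong (_* (1 + r * q)) (length-allFin k) ⟩
        k * (1 + r * q)                            ∎
        where open ≤-Reasoning

      danger : (Fin k → V) → V → ℕ
      danger C v = ∑[ w ∈ vs ] pathCost (threat C) v w

      -- Costs are natural numbers, so from a good `v` the paths to more than half of all `w` cost
      -- nothing.
      Good : (Fin k → V) → V → Set
      Good C v = 2 * danger C v < N

      -- The bound `few` makes the average cost over all pairs of vertices at most 1/4.
      ∑-danger : ∀ C → 4 * ∑ vs (danger C) ≤ N * N
      ∑-danger C = begin
        4 * ∑ vs (danger C)                       ≡⟨ cong (4 *_) (∑-pathCost (threat C)) ⟩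
        4 * (suc r * (N * ∑ vs (threat C)))       ≤⟨ *-monoʳ-≤ 4 (*-monoʳ-≤ (suc r) (*-monoʳ-≤ N (∑-threat C))) ⟩
        4 * (suc r * (N * (k * (1 + r * q))))     ≡⟨ rearrange N (suc r) (k * (1 + r * q)) ⟩
        N * (4 * (suc r * (k * (1 + r * q))))     ≤⟨ *-monoʳ-≤ N few ⟩
        N * N                                     ∎
        where
        open ≤-Reasoning
        rearrange : ∀ a b c → 4 * (b * (a * c)) ≡ a * (4 * (b * c))
        rearrange = solve-∀

      -- On average `N * b w` is below `N / 2` and `2 * danger C w` is at most `N / 2`, so for some
      -- `w` their sum is below `N`. This gives goodness, and `b w ≡ 0` by integrality. Here `b`
      -- stands for the cost of leaving `v` past the old placement, while `C` is the new one.
      choose : ∀ (b : V → ℕ) → 2 * ∑ vs b < N → ∀ C → ∃[ w ] (Good C w × b w ≡ 0)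
      choose b few-b C = map₂
        (λ {w} lt → ≤-<-trans (m≤n+m (2 * danger C w) (N * b w)) lt , m*n<m⇒n≡0 (≤-<-trans (m≤m+n _ _) lt))
        (∑-<⇒∃ vs {λ w → N * b w + 2 * danger C w} {λ _ → N} total)
        where
        rearrange : ∀ N B D → 2 * (N * B + 2 * D) ≡ N * (2 * B) + 4 * D
        rearrange = solve-∀

        total : ∑[ w ∈ vs ] (N * b w + 2 * danger C w) < ∑[ _ ∈ vs ] N
        total = *-cancelˡ-< 2 _ _ $ begin-strict
          2 * ∑[ w ∈ vs ] (N * b w + 2 * danger C w)
            ≡⟨ cong (2 *_) (trans (∑-+ vs _ _) (cong₂ _+_ (∑-*ˡ vs N b) (∑-*ˡ vs 2 _))) ⟩
          2 * (N * ∑ vs b + 2 * ∑ vs (danger C))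
            ≡⟨ rearrange N (∑ vs b) (∑ vs (danger C)) ⟩
          N * (2 * ∑ vs b) + 4 * ∑ vs (danger C)
            <⟨ +-mono-<-≤ (*-monoʳ-< N {{>-nonZero N>0}} few-b) (∑-danger C) ⟩
          N * N + N * N
            ≡⟨ cong (N * N +_) (+-identityʳ (N * N)) ⟨
          2 * (N * N)
            ≡⟨ cong (2 *_) (∑-constᴺ N) ⟨
          2 * ∑[ _ ∈ vs ] N ∎
          where open ≤-Reasoning

      -- All `N` paths counted by `danger C v` begin at `v`, so one threat to `v` already makes the
      -- danger at least `N`.
      good⇒unthreatened : ∀ C v → Good C v → Unthreatened [ r ] k C v
      good⇒unthreatened C v good = unthreatened C v (m*n<m⇒n≡0 (begin-strict
        N * threat C v              ≡⟨ ∑-constᴺ (threat C v) ⟨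
        ∑[ _ ∈ vs ] threat C v      ≤⟨ ∑-mono vs (x≤pathCost (threat C) v) ⟩
        danger C v                  ≤⟨ m≤n*m (danger C v) 2 ⟩
        2 * danger C v              <⟨ good ⟩
        N                           ∎))
        where open ≤-Reasoning

      start : ∀ C → ∃[ v ] Good C v
      start C = map₂ proj₁ (choose (λ _ → 0)
        (subst (_< N) (sym (trans (cong (2 *_) (∑-constᴺ 0)) (cong (2 *_) (*-zeroʳ N)))) N>0) C)

      evade : ¬ Game.CopsWin graph [ r ] k
      evade = robberEvades [ r ] k Good (λ {C} {v} → good⇒unthreatened C v) start
        λ {C} {v} C′ good → map₂
          (λ {w} (good′ , eq) → good′ , r , [ ≤-refl ] ,
             walk-map id id (λ {u} → unthreatened C u) (path (threat C) v w eq))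
          (choose (pathCost (threat C) v) good C′)

-- Arithmetic of the finite-speed bound.

floorRoot : ∀ r n → ∃[ q ] (q ^ suc r ≤ n × n < suc q ^ suc r)
floorRoot r zero = 0 , z≤n , m^n>0 1 (suc r)
floorRoot r (suc n) with q , lo , hi ← floorRoot r n | suc n <? suc q ^ suc r
... | yes lt = q , m≤n⇒m≤1+n lo , lt
... | no  ge = suc q , ≮⇒≥ ge , ≤-<-trans hi (^-monoˡ-< (suc r) ≤-refl)

module FiniteSpeed (t : ℕ) where

  -- `K` gathers the constants of `few` after `1 + r * q ≤ suc r * q`. A `q` of at least `M` pays
  -- for `K ^ suc t` and for replacing `n` by `(2 * q) ^ r` in `n ^ t`.
  r K M : ℕ
  r = 3 + t
  K = 4 * (suc r * suc r)
  M = K ^ suc t * 2 ^ (r * t)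

  M>0 : 0 < M
  M>0 = *-mono-≤ (m^n>0 K (suc t)) (m^n>0 2 (r * t))

  module _ {n q : ℕ} (M≤q : M ≤ q) (n<[1+q]^r : n < suc q ^ r) where

    q>0 : 0 < q
    q>0 = ≤-trans M>0 M≤q

    -- With `t = r - 3`, the identity (r-1)(r-2) = r(r-3) + 2 leaves two spare factors `q` between
    -- `(q ^ (2 + t)) ^ suc t` and `q ^ (r * t)`, and one of them absorbs `M`.
    fewCops : ∀ k → k ^ suc t < n ^ t → K * k ≤ q ^ (2 + t)
    fewCops k below = ≮⇒≥ λ many → <-irrefl refl (begin-strict
      q ^ (r * t) * q                            ≤⟨ *-monoʳ-≤ (q ^ (r * t)) (m≤m*n q q {{>-nonZero q>0}}) ⟩
      q ^ (r * t) * (q * q)                      ≡⟨ exponents ⟩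
      (q ^ (2 + t)) ^ suc t                      ≤⟨ ^-monoˡ-≤ (suc t) (<⇒≤ many) ⟩
      (K * k) ^ suc t                            ≡⟨ ^-distribʳ-* (suc t) K k ⟩
      K ^ suc t * k ^ suc t                      <⟨ *-monoʳ-< (K ^ suc t) {{>-nonZero (m^n>0 K (suc t))}} below ⟩
      K ^ suc t * n ^ t                          ≤⟨ *-monoʳ-≤ (K ^ suc t) (^-monoˡ-≤ t (<⇒≤ n<[1+q]^r)) ⟩
      K ^ suc t * (suc q ^ r) ^ t                ≡⟨ cong (K ^ suc t *_) (^-*-assoc (suc q) r t) ⟩
      K ^ suc t * suc q ^ (r * t)                ≤⟨ *-monoʳ-≤ (K ^ suc t) (^-monoˡ-≤ (r * t) 1+q≤2q) ⟩
      K ^ suc t * (2 * q) ^ (r * t)              ≡⟨ cong (K ^ suc t *_) (^-distribʳ-* (r * t) 2 q) ⟩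
      K ^ suc t * (2 ^ (r * t) * q ^ (r * t))    ≡⟨ *-assoc (K ^ suc t) _ _ ⟨
      M * q ^ (r * t)                            ≤⟨ *-monoˡ-≤ (q ^ (r * t)) M≤q ⟩
      q * q ^ (r * t)                            ≡⟨ *-comm q _ ⟩
      q ^ (r * t) * q                            ∎)
      where
      open ≤-Reasoning
      1+q≤2q : suc q ≤ 2 * q
      1+q≤2q = ≤-trans (+-monoˡ-≤ q q>0) (≤-reflexive (cong (q +_) (sym (+-identityʳ q))))

      degrees : ∀ t → (3 + t) * t + 2 ≡ (2 + t) * suc t
      degrees = solve-∀

      exponents : q ^ (r * t) * (q * q) ≡ (q ^ (2 + t)) ^ suc t
      exponents = begin-equality
        q ^ (r * t) * (q * q)       ≡⟨ cong (λ z → q ^ (r * t) * (q * z)) (*-identityʳ q) ⟨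
        q ^ (r * t) * q ^ 2         ≡⟨ ^-distribˡ-+-* q (r * t) 2 ⟨
        q ^ (r * t + 2)             ≡⟨ cong (q ^_) (degrees t) ⟩
        q ^ ((2 + t) * suc t)       ≡⟨ ^-*-assoc q (2 + t) (suc t) ⟨
        (q ^ (2 + t)) ^ suc t       ∎

    fewThreats : ∀ k → k ^ suc t < n ^ t → 4 * (suc r * (k * (1 + r * q))) ≤ q ^ r
    fewThreats k below = begin
      4 * (suc r * (k * (1 + r * q)))
        ≤⟨ *-monoʳ-≤ 4 (*-monoʳ-≤ (suc r) (*-monoʳ-≤ k (+-monoˡ-≤ (r * q) q>0))) ⟩
      4 * (suc r * (k * (suc r * q)))
        ≡⟨ rearrange (suc r) k q ⟩
      q * (K * k)
        ≤⟨ *-monoʳ-≤ q (fewCops k below) ⟩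
      q ^ r ∎
      where
      open ≤-Reasoning
      rearrange : ∀ a k q → 4 * (a * (k * (a * q))) ≡ q * (4 * (a * a) * k)
      rearrange = solve-∀

  hammingGraph : ∀ n → M ^ r ≤ n → Σ[ G ∈ Graph n ] (Connected G × CopsRequired G [ r ] (BelowPower r n))
  hammingGraph n n₀≤n with q , q^r≤n , n<[1+q]^r ← floorRoot (2 + t) n =
    graph , graph-connected , λ k below → evade (fewThreats M≤q n<[1+q]^r k below)
    where
    M≤q : M ≤ q
    M≤q = ≮⇒≥ λ q<M → <⇒≱ n<[1+q]^r (≤-trans (^-monoˡ-≤ r q<M) n₀≤n)

    open Hamming.Evasion {q} {r} {n} (≤-trans M>0 M≤q) q^r≤n

-- Cardinalities and geometric decay.

card : ∀ {n} {P : Fin n → Set} → Decidable P → ℕ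
card {n} P? = ∑[ x ∈ allFin n ] ⟦ P? x ⟧

0<*⇒0<ˡ : ∀ m n → 0 < m * n → 0 < m
0<*⇒0<ˡ (suc _) n _ = s≤s z≤n

0<*⇒0<ʳ : ∀ m n → 0 < m * n → 0 < n
0<*⇒0<ʳ m n lt = 0<*⇒0<ˡ n m (subst (0 <_) (*-comm m n) lt)

-- The bound x ≤ (q/p)^t y with denominators cleared, carried on by one more factor q/p.
decay : ∀ p q t {x x⁺ y} → p * x⁺ ≤ q * x → p ^ t * x ≤ q ^ t * y → p ^ suc t * x⁺ ≤ q ^ suc t * y
decay p q t {x} {x⁺} {y} x⁺≤x x≤y = begin
  p * p ^ t * x⁺    ≡⟨ reassoc p (p ^ t) x⁺ ⟩
  p ^ t * (p * x⁺)  ≤⟨ *-monoʳ-≤ (p ^ t) x⁺≤x ⟩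
  p ^ t * (q * x)   ≡⟨ reassoc q (p ^ t) x ⟨
  q * p ^ t * x     ≡⟨ *-assoc q (p ^ t) x ⟩
  q * (p ^ t * x)   ≤⟨ *-monoʳ-≤ q x≤y ⟩
  q * (q ^ t * y)   ≡⟨ *-assoc q (q ^ t) y ⟨
  q * q ^ t * y     ∎
  where
  open ≤-Reasoning
  reassoc : ∀ p m x → p * m * x ≡ m * (p * x)
  reassoc = solve-∀

vanish : ∀ p {x} m → x ≡ 0 → p * x ≤ m
vanish p m refl = ≤-trans (≤-reflexive (*-zeroʳ p)) z≤n

-- The bound on `m` is (q^j s / p^j)^n, which is less than 1, and `m` is a natural number.
collapse : ∀ p q s j n {m} → q ^ j * s < p ^ j → 0 < n → p ^ (j * n) * m ≤ q ^ (j * n) * s ^ n → m ≡ 0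
collapse p q s j n {zero}  _  _   _  = refl
collapse p q s j n {suc m} lt n>0 le = contradiction le (<⇒≱ (begin-strict
  q ^ (j * n) * s ^ n    ≡⟨ cong (_* s ^ n) (^-*-assoc q j n) ⟨
  (q ^ j) ^ n * s ^ n    ≡⟨ ^-distribʳ-* n (q ^ j) s ⟨
  (q ^ j * s) ^ n        <⟨ ^-monoˡ-< n {{>-nonZero n>0}} lt ⟩
  (p ^ j) ^ n            ≡⟨ ^-*-assoc p j n ⟩
  p ^ (j * n)            ≤⟨ m≤m*n (p ^ (j * n)) (suc m) ⟩
  p ^ (j * n) * suc m    ∎))
  where open ≤-Reasoning

-- Greedy construction of a bounded-degree expander.

module Expander {n : ℕ} (n>0 : 0 < n) where

  vs : List (Fin n)
  vs = allFin n

  -- Edge multiplicities: adding an edge is then addition, degrees and cuts are linear, and a degree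
  -- bounds the number of neighbours from above.
  Weights : Set
  Weights = Fin n → Fin n → ℕ

  Colouring : Set
  Colouring = Vec (Fin 3) n

  degree : Weights → Fin n → ℕ
  degree W x = ∑[ y ∈ vs ] W x y

  -- The loops make closeness reflexive, as `Blowup` requires, and let degrees bound closed
  -- neighbourhoods.
  path : Weights
  path x y = ⟦ toℕ x ≟ toℕ y ⟧ + (⟦ suc (toℕ x) ≟ toℕ y ⟧ + ⟦ toℕ x ≟ suc (toℕ y) ⟧)

  path-sym : ∀ x y → path x y ≡ path y x
  path-sym x y = cong₂ _+_ (⟦⟧-cong (toℕ x ≟ toℕ y) (toℕ y ≟ toℕ x) sym sym)
    (trans (+-comm ⟦ suc (toℕ x) ≟ toℕ y ⟧ _)
      (cong₂ _+_ (⟦⟧-cong (toℕ x ≟ suc (toℕ y)) (suc (toℕ y) ≟ toℕ x) sym sym)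
                 (⟦⟧-cong (suc (toℕ x) ≟ toℕ y) (toℕ y ≟ suc (toℕ x)) sym sym)))

  degree-path : ∀ x → degree path x ≤ 3
  degree-path x = begin
    degree path x
      ≡⟨ trans (∑-+ vs _ _) (cong (∑[ y ∈ vs ] ⟦ toℕ x ≟ toℕ y ⟧ +_) (∑-+ vs _ _)) ⟩
    ∑[ y ∈ vs ] ⟦ toℕ x ≟ toℕ y ⟧ +
    (∑[ y ∈ vs ] ⟦ suc (toℕ x) ≟ toℕ y ⟧ + ∑[ y ∈ vs ] ⟦ toℕ x ≟ suc (toℕ y) ⟧)
      ≤⟨ +-mono-≤ (unique λ p q → trans (sym p) q)
           (+-mono-≤ (unique λ p q → trans (sym p) q)
                     (unique λ p q → suc-injective (trans (sym p) q))) ⟩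
    3 ∎
    where
    open ≤-Reasoning
    unique : ∀ {P : Fin n → Set} {P? : Decidable P} →
             (∀ {y z} → P y → P z → toℕ y ≡ toℕ z) → card P? ≤ 1
    unique {P? = P?} inj = ∑-⟦⟧-unique (allFin⁺ n) P? λ p q → Fin.toℕ-injective (inj p q)

  link : Fin n → Fin n → Weights
  link a b x y = ⟦ x Fin.≟ a ⟧ * ⟦ y Fin.≟ b ⟧ + ⟦ x Fin.≟ b ⟧ * ⟦ y Fin.≟ a ⟧

  link-sym : ∀ a b x y → link a b x y ≡ link a b y x
  link-sym a b x y = rearrange ⟦ x Fin.≟ a ⟧ ⟦ y Fin.≟ b ⟧ ⟦ x Fin.≟ b ⟧ ⟦ y Fin.≟ a ⟧
    where
    rearrange : ∀ xa yb xb ya → xa * yb + xb * ya ≡ ya * xb + yb * xa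
    rearrange = solve-∀

  ∑-point : ∀ a → ∑[ x ∈ vs ] ⟦ x Fin.≟ a ⟧ ≤ 1
  ∑-point a = ∑-⟦⟧-unique (allFin⁺ n) (Fin._≟ a) λ p q → trans p (sym q)

  degree-link : ∀ a b x → degree (link a b) x ≤ ⟦ x Fin.≟ a ⟧ + ⟦ x Fin.≟ b ⟧
  degree-link a b x = begin
    degree (link a b) x
      ≡⟨ trans (∑-+ vs _ _) (cong₂ _+_ (∑-*ˡ vs ⟦ x Fin.≟ a ⟧ _) (∑-*ˡ vs ⟦ x Fin.≟ b ⟧ _)) ⟩
    ⟦ x Fin.≟ a ⟧ * ∑[ y ∈ vs ] ⟦ y Fin.≟ b ⟧ + ⟦ x Fin.≟ b ⟧ * ∑[ y ∈ vs ] ⟦ y Fin.≟ a ⟧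
      ≤⟨ +-mono-≤ (*-monoʳ-≤ ⟦ x Fin.≟ a ⟧ (∑-point b)) (*-monoʳ-≤ ⟦ x Fin.≟ b ⟧ (∑-point a)) ⟩
    ⟦ x Fin.≟ a ⟧ * 1 + ⟦ x Fin.≟ b ⟧ * 1
      ≡⟨ cong₂ _+_ (*-identityʳ ⟦ x Fin.≟ a ⟧) (*-identityʳ ⟦ x Fin.≟ b ⟧) ⟩
    ⟦ x Fin.≟ a ⟧ + ⟦ x Fin.≟ b ⟧ ∎
    where open ≤-Reasoning

  ∑-degree-link : ∀ a b → ∑ vs (degree (link a b)) ≤ 2
  ∑-degree-link a b = begin
    ∑ vs (degree (link a b))                                    ≤⟨ ∑-mono vs (degree-link a b) ⟩
    ∑[ x ∈ vs ] (⟦ x Fin.≟ a ⟧ + ⟦ x Fin.≟ b ⟧)                 ≡⟨ ∑-+ vs _ _ ⟩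
    ∑[ x ∈ vs ] ⟦ x Fin.≟ a ⟧ + ∑[ x ∈ vs ] ⟦ x Fin.≟ b ⟧       ≤⟨ +-mono-≤ (∑-point a) (∑-point b) ⟩
    2 ∎
    where open ≤-Reasoning

  1≤link : ∀ a b → 1 ≤ link a b a b
  1≤link a b rewrite ⟦⟧-yes (a Fin.≟ a) refl | ⟦⟧-yes (b Fin.≟ b) refl = s≤s z≤n

  red blue : Colouring → Fin n → ℕ
  red  χ x = ⟦ lookup χ x Fin.≟ zero ⟧
  blue χ x = ⟦ lookup χ x Fin.≟ suc zero ⟧

  cut : Weights → Colouring → ℕ
  cut W χ = ∑[ x ∈ vs ] ∑[ y ∈ vs ] (red χ x * blue χ y * W x y)

  -- The red and blue classes of an alive colouring show that W does not expand.
  Alive : Weights → Colouring → Set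
  Alive W χ = n ≤ 5 * ∑ vs (red χ) × n ≤ 5 * ∑ vs (blue χ) × cut W χ ≡ 0

  alive? : ∀ W χ → Dec (Alive W χ)
  alive? W χ = (n ≤? 5 * ∑ vs (red χ)) ×-dec (n ≤? 5 * ∑ vs (blue χ)) ×-dec (cut W χ ≟ 0)

  alives : Weights → ℕ
  alives W = ∑[ χ ∈ vectors 3 n ] ⟦ alive? W χ ⟧

  -- Adding edges between vertices of small degree one at a time, each chosen
  -- to kill at least one hundredth of the remaining alive colourings.  The
  -- number c bounds the average degree, and 10 c the degrees of the endpoints
  -- of the new edges, so that at most a tenth of the vertices is excluded.
  module _ (c T : ℕ) (c>0 : 0 < c) (budget : 3 * n + 2 * T ≤ c * n) where

    record Stage (t : ℕ) : Set where
      field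
        W          : Weights
        W-sym      : ∀ x y → W x y ≡ W y x
        path≤W     : ∀ x y → path x y ≤ W x y
        ∑-degree   : ∑ vs (degree W) ≤ 3 * n + 2 * t
        -- An endpoint of a new edge has degree below `10 * c` beforehand and gains at most 2; the 3
        -- covers the path.
        degree≤    : ∀ x → degree W x ≤ 2 + (10 * c + 3)
        few-alives : 100 ^ t * alives W ≤ 99 ^ t * 3 ^ n

    first : Stage 0
    first = record
      { W          = path
      ; W-sym      = path-sym
      ; path≤W     = λ x y → ≤-refl
      ; ∑-degree   = begin
          ∑ vs (degree path)   ≤⟨ ∑-bound vs degree-path ⟩
          length vs * 3        ≡⟨ cong (_* 3) (length-allFin n) ⟩
          n * 3                ≡⟨ trans (*-comm n 3) (sym (+-identityʳ (3 * n))) ⟩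
          3 * n + 2 * 0        ∎
      ; degree≤    = λ x → ≤-trans (degree-path x) (≤-trans (m≤n+m 3 (10 * c)) (m≤n+m _ 2))
      ; few-alives = begin
          1 * alives path                   ≡⟨ *-identityˡ _ ⟩
          alives path                       ≤⟨ ∑-bound (vectors 3 n) (λ χ → ⟦⟧≤1 (alive? path χ)) ⟩
          length (vectors 3 n) * 1          ≡⟨ *-identityʳ _ ⟩
          length (vectors 3 n)              ≡⟨ length-vectors 3 n ⟩
          3 ^ n                             ≡⟨ *-identityˡ _ ⟨
          1 * 3 ^ n                         ∎
      }
      where open ≤-Reasoning

    module _ {t} (t<T : t < T) (stage : Stage t) where
      open Stage stage

      low? : Decidable (λ x → degree W x < 10 * c)
      low? x = degree W x <? 10 * c

      high? : Decidable (λ x → 10 * c ≤ degree W x)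
      high? x = 10 * c ≤? degree W x

      -- Markov's inequality for the degrees, whose sum is at most `c * n`.
      few-high : 10 * card high? ≤ n
      few-high = *-cancelˡ-≤ c {{>-nonZero c>0}} $ begin
        c * (10 * card high?)                  ≡⟨ rearrange c (card high?) ⟩
        card high? * (10 * c)                  ≡⟨ ∑-*ʳ vs (10 * c) _ ⟨
        ∑[ x ∈ vs ] (⟦ high? x ⟧ * (10 * c))   ≤⟨ ∑-mono vs high≤degree ⟩
        ∑ vs (degree W)                        ≤⟨ ∑-degree ⟩
        3 * n + 2 * t                          ≤⟨ +-monoʳ-≤ (3 * n) (*-monoʳ-≤ 2 (<⇒≤ t<T)) ⟩
        3 * n + 2 * T                          ≤⟨ budget ⟩
        c * n                                  ∎
        where
        open ≤-Reasoning
        rearrange : ∀ c h → c * (10 * h) ≡ h * (10 * c)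
        rearrange = solve-∀

        high≤degree : ∀ x → ⟦ high? x ⟧ * (10 * c) ≤ degree W x
        high≤degree x with high? x
        ... | yes high = ≤-trans (≤-reflexive (*-identityˡ _)) high
        ... | no  _    = z≤n

      -- At most n/10 of the n/5 vertices have high degree.
      many-low : ∀ {P : Fin n → Set} (P? : Decidable P) → n ≤ 5 * card P? →
                 n ≤ 10 * ∑[ x ∈ vs ] (⟦ P? x ⟧ * ⟦ low? x ⟧)
      many-low P? large = +-cancelʳ-≤ n _ _ $ begin
        n + n                                          ≤⟨ +-mono-≤ large large ⟩
        5 * card P? + 5 * card P?                      ≡⟨ *-distribʳ-+ (card P?) 5 5 ⟨
        10 * card P?                                   ≤⟨ *-monoʳ-≤ 10 (∑-mono vs low-or-high) ⟩
        10 * ∑[ x ∈ vs ] (⟦ P? x ⟧ * ⟦ low? x ⟧ + ⟦ high? x ⟧)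
          ≡⟨ trans (cong (10 *_) (∑-+ vs _ _)) (*-distribˡ-+ 10 lows _) ⟩
        10 * lows + 10 * card high?                    ≤⟨ +-monoʳ-≤ (10 * lows) few-high ⟩
        10 * lows + n                                  ∎
        where
        open ≤-Reasoning
        lows = ∑[ x ∈ vs ] (⟦ P? x ⟧ * ⟦ low? x ⟧)

        low-or-high : ∀ x → ⟦ P? x ⟧ ≤ ⟦ P? x ⟧ * ⟦ low? x ⟧ + ⟦ high? x ⟧
        low-or-high x with low? x
        ... | yes _    = ≤-trans (≤-reflexive (sym (*-identityʳ _))) (m≤m+n _ _)
        ... | no  ¬low rewrite ⟦⟧-yes (high? x) (≮⇒≥ ¬low) = ≤-trans (⟦⟧≤1 (P? x)) (m≤n+m 1 _)

      -- Counts, for a and b of small degree, the alive colourings that the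
      -- edge a b kills.
      hits : Colouring → Fin n → Fin n → ℕ
      hits χ a b = red χ a * ⟦ low? a ⟧ * (blue χ b * ⟦ low? b ⟧)

      kills : Fin n → Fin n → ℕ
      kills a b = ∑[ χ ∈ vectors 3 n ] (⟦ alive? W χ ⟧ * hits χ a b)

      -- Source of the hundredth: at least n/10 red and n/10 blue vertices are low, and each such
      -- pair is a hit.
      many-hits : ∀ χ → ⟦ alive? W χ ⟧ * (n * n) ≤
                  100 * ∑[ a ∈ vs ] ∑[ b ∈ vs ] (⟦ alive? W χ ⟧ * hits χ a b)
      many-hits χ = go (alive? W χ)
        where
        open ≤-Reasoning
        ρ β : Fin n → ℕ
        ρ a = red χ a * ⟦ low? a ⟧
        β b = blue χ b * ⟦ low? b ⟧

        go : (al : Dec (Alive W χ)) →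
             ⟦ al ⟧ * (n * n) ≤ 100 * ∑[ a ∈ vs ] ∑[ b ∈ vs ] (⟦ al ⟧ * hits χ a b)
        go (no  _)                  = z≤n
        go (yes (reds , blues , _)) = begin
          1 * (n * n)                      ≡⟨ *-identityˡ (n * n) ⟩
          n * n                            ≤⟨ *-mono-≤ (many-low (λ x → lookup χ x Fin.≟ zero) reds)
                                                       (many-low (λ x → lookup χ x Fin.≟ suc zero) blues) ⟩
          10 * ∑ vs ρ * (10 * ∑ vs β)      ≡⟨ [m*n]*[o*p]≡[m*o]*[n*p] 10 (∑ vs ρ) 10 (∑ vs β) ⟩
          100 * (∑ vs ρ * ∑ vs β)          ≡⟨ cong (100 *_) (∑-product vs vs ρ β) ⟨
          100 * ∑[ a ∈ vs ] ∑[ b ∈ vs ] (ρ a * β b)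
            ≡⟨ cong (100 *_) (∑-cong vs λ a → ∑-cong vs λ b → *-identityˡ (ρ a * β b)) ⟨
          100 * ∑[ a ∈ vs ] ∑[ b ∈ vs ] (1 * (ρ a * β b)) ∎

      -- Double counting of colourings and pairs: an average pair kills at least a hundredth of the
      -- alive colourings.
      ∑-kills : ∑[ a ∈ vs ] ∑[ b ∈ vs ] alives W ≤ ∑[ a ∈ vs ] ∑[ b ∈ vs ] (100 * kills a b)
      ∑-kills = begin
        ∑[ a ∈ vs ] ∑[ b ∈ vs ] alives W
          ≡⟨ trans (∑-cong vs λ _ → ∑-allFin-const n _) (∑-allFin-const n _) ⟩
        n * (n * alives W)
          ≡⟨ rearrange n (alives W) ⟩
        alives W * (n * n)
          ≡⟨ ∑-*ʳ χs (n * n) _ ⟨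
        ∑[ χ ∈ χs ] (⟦ alive? W χ ⟧ * (n * n))
          ≤⟨ ∑-mono χs many-hits ⟩
        ∑[ χ ∈ χs ] (100 * ∑[ a ∈ vs ] ∑[ b ∈ vs ] (⟦ alive? W χ ⟧ * hits χ a b))
          ≡⟨ ∑-*ˡ χs 100 _ ⟩
        100 * ∑[ χ ∈ χs ] ∑[ a ∈ vs ] ∑[ b ∈ vs ] (⟦ alive? W χ ⟧ * hits χ a b)
          ≡⟨ cong (100 *_) (trans (∑-swap χs vs _) (∑-cong vs λ a → ∑-swap χs vs _)) ⟩
        100 * ∑[ a ∈ vs ] ∑[ b ∈ vs ] kills a b
          ≡⟨ trans (sym (∑-*ˡ vs 100 _)) (∑-cong vs λ a → sym (∑-*ˡ vs 100 _)) ⟩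
        ∑[ a ∈ vs ] ∑[ b ∈ vs ] (100 * kills a b) ∎
        where
        open ≤-Reasoning
        χs = vectors 3 n
        rearrange : ∀ n a → n * (n * a) ≡ a * (n * n)
        rearrange = solve-∀

      deadly-edge : ∃[ a ] ∃[ b ] alives W ≤ 100 * kills a b
      deadly-edge = map₂ (∑-≤⇒∃ vs vs>0) (∑-≤⇒∃ vs vs>0 ∑-kills)
        where
        vs>0 : 0 < length vs
        vs>0 = subst (0 <_) (sym (length-allFin n)) n>0

      -- The factors `low?` inside `hits` make any single kill certify both ends.
      low-ends : ∀ a b → 0 < kills a b → degree W a < 10 * c × degree W b < 10 * c
      low-ends a b pos
        with χ , hit ← ∑-pos⇒∃ (vectors 3 n) pos
        with hit′ ← 0<*⇒0<ʳ ⟦ alive? W χ ⟧ (hits χ a b) hit =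
        ⟦⟧-pos (low? a) (0<*⇒0<ʳ (red χ a) _ (0<*⇒0<ˡ (red χ a * ⟦ low? a ⟧) _ hit′)) ,
        ⟦⟧-pos (low? b) (0<*⇒0<ʳ (blue χ b) _ (0<*⇒0<ʳ (red χ a * ⟦ low? a ⟧) _ hit′))

      module _ (a b : Fin n) where

        W⁺ : Weights
        W⁺ x y = W x y + link a b x y

        degree-W⁺ : ∀ x → degree W⁺ x ≡ degree W x + degree (link a b) x
        degree-W⁺ x = ∑-+ vs (W x) (link a b x)

        cut≤cut⁺ : ∀ χ → cut W χ ≤ cut W⁺ χ
        cut≤cut⁺ χ = ∑-mono vs λ x → ∑-mono vs λ y → *-monoʳ-≤ (red χ x * blue χ y) (m≤m+n (W x y) _)

        red*blue≤cut⁺ : ∀ χ → red χ a * blue χ b ≤ cut W⁺ χ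
        red*blue≤cut⁺ χ = begin
          red χ a * blue χ b                      ≡⟨ *-identityʳ _ ⟨
          red χ a * blue χ b * 1                  ≤⟨ *-monoʳ-≤ (red χ a * blue χ b)
                                                       (≤-trans (1≤link a b) (m≤n+m (link a b a b) (W a b))) ⟩
          red χ a * blue χ b * W⁺ a b             ≤⟨ ∑-∈ (λ y → red χ a * blue χ y * W⁺ a y) (∈-allFin b) ⟩
          ∑[ y ∈ vs ] (red χ a * blue χ y * W⁺ a y)
            ≤⟨ ∑-∈ (λ x → ∑[ y ∈ vs ] (red χ x * blue χ y * W⁺ x y)) (∈-allFin a) ⟩
          cut W⁺ χ ∎
          where open ≤-Reasoning

        -- If `a` is red and `b` is blue, the new edge lies in the cut, so no colouring is both hit
        -- and alive afterwards; and adding edges revives none.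
        survive : ∀ χ → ⟦ alive? W⁺ χ ⟧ + ⟦ alive? W χ ⟧ * hits χ a b ≤ ⟦ alive? W χ ⟧
        survive χ with alive? W⁺ χ
        ... | no  _ = ≤-trans (*-monoʳ-≤ ⟦ alive? W χ ⟧ hits≤1) (≤-reflexive (*-identityʳ _))
          where
          hits≤1 : hits χ a b ≤ 1
          hits≤1 = *-mono-≤ (*-mono-≤ (⟦⟧≤1 (lookup χ a Fin.≟ zero)) (⟦⟧≤1 (low? a)))
                            (*-mono-≤ (⟦⟧≤1 (lookup χ b Fin.≟ suc zero)) (⟦⟧≤1 (low? b)))
        ... | yes (reds , blues , cut≡0)
          rewrite ⟦⟧-yes (alive? W χ) (reds , blues , n≤0⇒n≡0 (subst (cut W χ ≤_) cut≡0 (cut≤cut⁺ χ)))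
                = s≤s (≤-reflexive (trans (+-identityʳ _) hits≡0))
          where
          rearrange : ∀ r l b m → r * l * (b * m) ≡ r * b * (l * m)
          rearrange = solve-∀

          hits≡0 : hits χ a b ≡ 0
          hits≡0 = trans (rearrange (red χ a) ⟦ low? a ⟧ (blue χ b) ⟦ low? b ⟧)
            (cong (_* (⟦ low? a ⟧ * ⟦ low? b ⟧)) (n≤0⇒n≡0 (subst (red χ a * blue χ b ≤_) cut≡0 (red*blue≤cut⁺ χ))))

        alives⁺ : alives W ≤ 100 * kills a b → 100 * alives W⁺ ≤ 99 * alives W
        alives⁺ deadly = +-cancelʳ-≤ (alives W) _ _ $ begin
          100 * alives W⁺ + alives W            ≤⟨ +-monoʳ-≤ (100 * alives W⁺) deadly ⟩
          100 * alives W⁺ + 100 * kills a b     ≡⟨ *-distribˡ-+ 100 (alives W⁺) _ ⟨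
          100 * (alives W⁺ + kills a b)         ≡⟨ cong (100 *_) (∑-+ (vectors 3 n) _ _) ⟨
          100 * ∑[ χ ∈ vectors 3 n ] (⟦ alive? W⁺ χ ⟧ + ⟦ alive? W χ ⟧ * hits χ a b)
                                                ≤⟨ *-monoʳ-≤ 100 (∑-mono (vectors 3 n) survive) ⟩
          100 * alives W                        ≡⟨ split (alives W) ⟩
          99 * alives W + alives W              ∎
          where
          open ≤-Reasoning
          split : ∀ m → 100 * m ≡ 99 * m + m
          split m = +-comm m (99 * m)

      -- Once no colouring is alive, a deadly edge may kill nothing, and then the degrees of its
      -- ends are not controlled; so no edge is added.
      keep : ¬ 0 < alives W → Stage (suc t)
      keep dead = record
        { W          = W
        ; W-sym      = W-sym
        ; path≤W     = path≤W
        ; ∑-degree   = ≤-trans ∑-degree (+-monoʳ-≤ (3 * n) (*-monoʳ-≤ 2 (n≤1+n t)))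
        ; degree≤    = degree≤
        ; few-alives = vanish (100 ^ suc t) (99 ^ suc t * 3 ^ n) (0≮n⇒n≡0 dead)
        }
      add : ∀ a b → alives W ≤ 100 * kills a b → 0 < alives W → Stage (suc t)
      add a b deadly pos = record
        { W          = W⁺ a b
        ; W-sym      = λ x y → cong₂ _+_ (W-sym x y) (link-sym a b x y)
        ; path≤W     = λ x y → ≤-trans (path≤W x y) (m≤m+n _ _)
        ; ∑-degree   = begin
            ∑ vs (degree (W⁺ a b))                          ≡⟨ trans (∑-cong vs (degree-W⁺ a b)) (∑-+ vs _ _) ⟩
            ∑ vs (degree W) + ∑ vs (degree (link a b))      ≤⟨ +-mono-≤ ∑-degree (∑-degree-link a b) ⟩
            3 * n + 2 * t + 2                               ≡⟨ rearrange n t ⟩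
            3 * n + 2 * suc t                               ∎
        ; degree≤    = degree⁺≤
        ; few-alives = decay 100 99 t (alives⁺ a b deadly) few-alives
        }
        where
        open ≤-Reasoning
        rearrange : ∀ n t → 3 * n + 2 * t + 2 ≡ 3 * n + 2 * suc t
        rearrange = solve-∀

        ends : degree W a < 10 * c × degree W b < 10 * c
        ends = low-ends a b (0<*⇒0<ʳ 100 (kills a b) (≤-trans pos deadly))

        degree⁺≤ : ∀ x → degree (W⁺ a b) x ≤ 2 + (10 * c + 3)
        degree⁺≤ x = ≤-trans (≤-reflexive (degree-W⁺ a b x))
          (≤-trans (+-monoʳ-≤ (degree W x) (degree-link a b x)) (bound (x Fin.≟ a) (x Fin.≟ b)))
          where
          low : degree W x < 10 * c → ∀ {m} → m ≤ 2 → degree W x + m ≤ 2 + (10 * c + 3)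
          low lt m≤2 = ≤-trans (+-mono-≤ (≤-trans (<⇒≤ lt) (m≤m+n _ 3)) m≤2) (≤-reflexive (+-comm (10 * c + 3) 2))

          bound : (x≟a : Dec (x ≡ a)) (x≟b : Dec (x ≡ b)) → degree W x + (⟦ x≟a ⟧ + ⟦ x≟b ⟧) ≤ 2 + (10 * c + 3)
          bound (yes refl) x≟b        = low (proj₁ ends) (s≤s (⟦⟧≤1 x≟b))
          bound (no _)     (yes refl) = low (proj₂ ends) (s≤s z≤n)
          bound (no _)     (no _)     = ≤-trans (≤-reflexive (+-identityʳ (degree W x))) (degree≤ x)

      extend : Stage (suc t)
      extend = go deadly-edge (0 <? alives W)
        where
        go : ∃[ a ] ∃[ b ] alives W ≤ 100 * kills a b → Dec (0 < alives W) → Stage (suc t)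
        go _                  (no dead) = keep dead
        go (a , b , deadly) (yes pos) = add a b deadly pos

    stages : ∀ t → t ≤ T → Stage t
    stages zero    _   = first
    stages (suc t) t<T = extend t<T (stages t (<⇒≤ t<T))

  Expands : Weights → Set₁
  Expands W = ∀ {P Q : Fin n → Set} (P? : Decidable P) (Q? : Decidable Q) → (∀ {x} → P x → ¬ Q x) →
    n ≤ 5 * card P? → n ≤ 5 * card Q? → ∃[ x ] ∃[ y ] (P x × Q y × 0 < W x y)

  -- Colour `P` red and `Q` blue. This colouring is not alive although both classes are large, so
  -- its cut has a positive term, which is an edge.
  none-alive⇒expands : ∀ W → alives W ≡ 0 → Expands W
  none-alive⇒expands W none-alive {P} {Q} P? Q? disjoint manyP manyQ =
    conclude (∑-pos⇒∃ vs (n≢0⇒n>0 cut≢0))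
    where
    colour : ∀ x → Dec (P x) → Dec (Q x) → Fin 3
    colour x (yes _) _       = zero
    colour x (no _)  (yes _) = suc zero
    colour x (no _)  (no _)  = suc (suc zero)

    χ : Colouring
    χ = tabulate λ x → colour x (P? x) (Q? x)

    lookup-χ : ∀ x → lookup χ x ≡ colour x (P? x) (Q? x)
    lookup-χ = Vec.lookup∘tabulate _

    red⇒P : ∀ x → lookup χ x ≡ zero → P x
    red⇒P x eq = go (P? x) (Q? x) (trans (sym (lookup-χ x)) eq)
      where
      go : ∀ p? q? → colour x p? q? ≡ zero → P x
      go (yes p) _       _  = p
      go (no _)  (yes _) ()
      go (no _)  (no _)  ()

    P⇒red : ∀ x → P x → lookup χ x ≡ zero
    P⇒red x p = trans (lookup-χ x) (go (P? x) (Q? x))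
      where
      go : ∀ p? q? → colour x p? q? ≡ zero
      go (yes _) _ = refl
      go (no ¬p) _ = contradiction p ¬p

    blue⇒Q : ∀ x → lookup χ x ≡ suc zero → Q x
    blue⇒Q x eq = go (P? x) (Q? x) (trans (sym (lookup-χ x)) eq)
      where
      go : ∀ p? q? → colour x p? q? ≡ suc zero → Q x
      go (yes _) _       ()
      go (no _)  (yes q) _  = q
      go (no _)  (no _)  ()

    Q⇒blue : ∀ x → Q x → lookup χ x ≡ suc zero
    Q⇒blue x q = trans (lookup-χ x) (go (P? x) (Q? x))
      where
      go : ∀ p? q? → colour x p? q? ≡ suc zero
      go (yes p) _       = contradiction q (disjoint p)
      go (no _)  (yes _) = refl
      go (no _)  (no ¬q) = contradiction q ¬q

    reds : n ≤ 5 * ∑ vs (red χ)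
    reds = subst (λ m → n ≤ 5 * m)
      (∑-cong vs λ x → ⟦⟧-cong (P? x) (lookup χ x Fin.≟ zero) (P⇒red x) (red⇒P x)) manyP

    blues : n ≤ 5 * ∑ vs (blue χ)
    blues = subst (λ m → n ≤ 5 * m)
      (∑-cong vs λ x → ⟦⟧-cong (Q? x) (lookup χ x Fin.≟ suc zero) (Q⇒blue x) (blue⇒Q x)) manyQ

    cut≢0 : cut W χ ≢ 0
    cut≢0 cut≡0 = contradiction
      (subst₂ _≤_ (⟦⟧-yes (alive? W χ) (reds , blues , cut≡0)) none-alive
        (∑-∈ (λ χ → ⟦ alive? W χ ⟧) (∈-vectors χ)))
      λ ()

    conclude : ∃[ x ] 0 < ∑[ y ∈ vs ] (red χ x * blue χ y * W x y) →
               ∃[ x ] ∃[ y ] (P x × Q y × 0 < W x y)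
    conclude (x , row>0) with y , pos ← ∑-pos⇒∃ vs row>0 =
      let ends>0 = 0<*⇒0<ˡ (red χ x * blue χ y) (W x y) pos in
      x , y ,
      red⇒P x (⟦⟧-pos (lookup χ x Fin.≟ zero) (0<*⇒0<ˡ (red χ x) (blue χ y) ends>0)) ,
      blue⇒Q y (⟦⟧-pos (lookup χ y Fin.≟ suc zero) (0<*⇒0<ʳ (red χ x) (blue χ y) ends>0)) ,
      0<*⇒0<ʳ (red χ x * blue χ y) (W x y) pos

  record Result : Set₁ where
    field
      W       : Weights
      W-sym   : ∀ x y → W x y ≡ W y x
      path≤W  : ∀ x y → path x y ≤ W x y
      degree≤ : ∀ x → degree W x ≤ 2235
      expands : Expands W

  expander : Result
  expander = record
    { W       = W
    ; W-sym   = W-sym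
    ; path≤W  = path≤W
    ; degree≤ = degree≤
    ; expands = none-alive⇒expands W none-alive
    }
    where
    budget : 3 * n + 2 * (110 * n) ≤ 223 * n
    budget = ≤-reflexive (trans (cong (3 * n +_) (sym (*-assoc 2 110 n))) (sym (*-distribʳ-+ n 3 220)))

    -- Here c = 223 = 3 + 2 * 110, for the path and `110 * n` new edges. The degree bound becomes 2
    -- + (2230 + 3) = 2235.
    open Stage (stages 223 (110 * n) (s≤s z≤n) budget (110 * n) ≤-refl)

    none-alive : alives W ≡ 0
    -- 110 is the least j with (100/99)^j > 3, so `110 * n` edges outweigh the `3 ^ n` colourings.
    none-alive = collapse 100 99 3 110 n (<ᵇ⇒< (99 ^ 110 * 3) (100 ^ 110) tt) n>0 few-alives

-- Cardinalities of unions and complements.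

module _ {n : ℕ} {P Q : Fin n → Set} (P? : Decidable P) (Q? : Decidable Q) where

  card-∪ : card (P? ∪? Q?) ≤ card P? + card Q?
  card-∪ = ≤-trans (∑-mono (allFin n) pointwise) (≤-reflexive (∑-+ (allFin n) _ _))
    where
    pointwise : ∀ x → ⟦ (P? ∪? Q?) x ⟧ ≤ ⟦ P? x ⟧ + ⟦ Q? x ⟧
    pointwise x with P? x | Q? x
    ... | yes _ | _     = s≤s z≤n
    ... | no  _ | yes _ = s≤s z≤n
    ... | no  _ | no  _ = z≤n

  card-< : (∀ {x} → P x → Q x) → ∀ {x} → ¬ P x → Q x → card P? < card Q?
  card-< P⊆Q {x} ¬px qx = ∑-mono-< (∈-allFin x) (λ y → ⟦⟧-mono (P? y) (Q? y) P⊆Q)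
    (subst₂ _<_ (sym (⟦⟧-no (P? x) ¬px)) (sym (⟦⟧-yes (Q? x) qx)) (s≤s z≤n))

module _ {n : ℕ} {P : Fin n → Set} (P? : Decidable P) where

  card≤n : card P? ≤ n
  card≤n = ≤-trans (∑-bound (allFin n) (λ x → ⟦⟧≤1 (P? x)))
                   (≤-reflexive (trans (*-identityʳ _) (length-allFin n)))

  n≤card+card-∁ : n ≤ card P? + card (¬? ∘ P?)
  n≤card+card-∁ = begin
    n                                                 ≡⟨ trans (∑-allFin-const n 1) (*-identityʳ n) ⟨
    ∑[ _ ∈ allFin n ] 1                               ≤⟨ ∑-mono (allFin n) (λ x → pointwise (P? x)) ⟩
    ∑[ x ∈ allFin n ] (⟦ P? x ⟧ + ⟦ ¬? (P? x) ⟧)      ≡⟨ ∑-+ (allFin n) _ _ ⟩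
    card P? + card (¬? ∘ P?)                          ∎
    where
    open ≤-Reasoning
    pointwise : ∀ {A : Set} (A? : Dec A) → 1 ≤ ⟦ A? ⟧ + ⟦ ¬? A? ⟧
    pointwise (yes _) = s≤s z≤n
    pointwise (no _)  = s≤s z≤n

-- 1/5 + 1/4 + 1/20 = 1/2.
fewer-than-half : ∀ {t k x p n} → 5 * t < n → 4 * k < n → 20 * x ≤ n → p ≤ t + k + x → 2 * p ≤ n
fewer-than-half {t} {k} {x} {p} {n} 5t<n 4k<n 20x≤n p≤ = *-cancelˡ-≤ 10 $ begin
  10 * (2 * p)                              ≤⟨ *-monoʳ-≤ 10 (*-monoʳ-≤ 2 p≤) ⟩
  10 * (2 * (t + k + x))                    ≡⟨ rearrange t k x ⟩
  4 * (5 * t) + 5 * (4 * k) + 20 * x        ≤⟨ +-mono-≤ (+-mono-≤ (*-monoʳ-≤ 4 (<⇒≤ 5t<n))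
                                                                     (*-monoʳ-≤ 5 (<⇒≤ 4k<n))) 20x≤n ⟩
  4 * n + 5 * n + n                         ≡⟨ collect n ⟩
  10 * n                                    ∎
  where
  open ≤-Reasoning
  rearrange : ∀ t k x → 10 * (2 * (t + k + x)) ≡ 4 * (5 * t) + 5 * (4 * k) + 20 * x
  rearrange = solve-∀
  collect : ∀ n → 4 * n + 5 * n + n ≡ 10 * n
  collect = solve-∀

-- Evasion at infinite speed.

module InfiniteSpeed {n : ℕ} (n>0 : 0 < n) (result : Expander.Result n>0) where

  open Expander.Result result
  open Expander n>0 using (path; degree)

  Close : Fin n → Fin n → Set
  Close x y = 0 < W x y

  close? : ∀ x y → Dec (Close x y)
  close? x y = 0 <? W x y

  -- The expander already has `n` vertices, so both maps are the identity and the graph is `Close`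
  -- without its loops.
  open Blowup {n} {Fin n} Close
    (λ {x} → ≤-trans (≤-trans (≤-reflexive (sym (⟦⟧-yes (toℕ x ≟ toℕ x) refl))) (m≤m+n _ _)) (path≤W x x))
    (λ {x} {y} → subst (0 <_) (W-sym x y)) close? id id (λ _ → refl) public

  successor-close : ∀ {x y} → suc (toℕ x) ≡ toℕ y → Close x y
  successor-close {x} {y} eq = begin
    1                                                                ≡⟨ ⟦⟧-yes (suc (toℕ x) ≟ toℕ y) eq ⟨
    ⟦ suc (toℕ x) ≟ toℕ y ⟧                                          ≤⟨ m≤m+n _ _ ⟩
    ⟦ suc (toℕ x) ≟ toℕ y ⟧ + ⟦ toℕ x ≟ suc (toℕ y) ⟧                ≤⟨ m≤n+m _ ⟦ toℕ x ≟ toℕ y ⟧ ⟩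
    path x y                                                         ≤⟨ path≤W x y ⟩
    W x y                                                            ∎
    where open ≤-Reasoning

  graph-connected : Connected graph
  graph-connected = connected walk
    where
    W⊤ : ℕ → Fin n → Fin n → Set
    W⊤ = Walk Close (λ _ → ⊤)

    both-ways : ∀ m u v → m + toℕ u ≡ toℕ v → W⊤ m u v × W⊤ m v u
    both-ways zero    u v eq with refl ← Fin.toℕ-injective eq = done , done
    both-ways (suc m) u v eq =
      let there′ , back = both-ways m u⁺ v (trans (cong (m +_) (sym 1+u≡u⁺)) (trans (+-suc m (toℕ u)) eq)) in
      step u~u⁺ tt there′ , snoc back (subst (0 <_) (W-sym u u⁺) u~u⁺) tt
      where
      1+u<n : suc (toℕ u) < n
      1+u<n = ≤-<-trans (≤-trans (s≤s (m≤n+m (toℕ u) m)) (≤-reflexive eq)) (Fin.toℕ<n v)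

      u⁺ : Fin n
      u⁺ = fromℕ< 1+u<n

      1+u≡u⁺ : suc (toℕ u) ≡ toℕ u⁺
      1+u≡u⁺ = sym (Fin.toℕ-fromℕ< 1+u<n)

      u~u⁺ : Close u u⁺
      u~u⁺ = successor-close 1+u≡u⁺

    walk : ∀ u v → ∃[ l ] W⊤ l u v
    walk u v with ≤-total (toℕ u) (toℕ v)
    ... | inj₁ u≤v = toℕ v ∸ toℕ u , proj₁ (both-ways _ u v (m∸n+n≡m u≤v))
    ... | inj₂ v≤u = toℕ u ∸ toℕ v , proj₂ (both-ways _ v u (m∸n+n≡m v≤u))

  module Escape {X : Fin n → Set} (X? : Decidable X) (few : 20 * card X? ≤ n) where

    Free : Fin n → Set
    Free v = ¬ X v

    -- A possibly incomplete component of `w`, with walks as evidence; completeness is expressed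
    -- separately by `Closed`.
    record Reachable (w : Fin n) : Set₁ where
      field
        K     : Fin n → Set
        K?    : Decidable K
        root  : K w
        reach : ∀ {v} → K v → ∃[ l ] Walk Close Free l w v

    Closed : (Fin n → Set) → Set
    Closed K = ∀ {x y} → K x → Close x y → K y ⊎ X y

    ∪-closed : ∀ {T K : Fin n → Set} → Closed T → Closed K → Closed (T ∪ K)
    ∪-closed T-closed K-closed (inj₁ x∈T) x~y = [ inj₁ ∘ inj₁ , inj₂ ]′ (T-closed x∈T x~y)
    ∪-closed T-closed K-closed (inj₂ x∈K) x~y = [ inj₁ ∘ inj₂ , inj₂ ]′ (K-closed x∈K x~y)

    singleton : ∀ w → Reachable w
    singleton w = record
      { K     = w ≡_
      ; K?    = w Fin.≟_
      ; root  = refl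
      ; reach = λ { refl → 0 , done }
      }

    component : ∀ w → Σ[ ℛ ∈ Reachable w ] Closed (Reachable.K ℛ)
    -- The fuel `m` bounds the number of vertices outside `K`, and each exit found moves one of them
    -- inside.
    component w = grow n (singleton w) (m≤m+n n _)
      where
      grow : ∀ m (ℛ : Reachable w) → n ≤ m + card (Reachable.K? ℛ) →
             Σ[ ℛ′ ∈ Reachable w ] Closed (Reachable.K ℛ′)
      grow m ℛ fuel = go m fuel (Fin.any? λ x → Fin.any? λ y →
          K? x ×-dec ¬? (K? y) ×-dec ¬? (X? y) ×-dec close? x y)
        where
        open Reachable ℛ
        Exit : Set
        Exit = ∃[ x ] ∃[ y ] (K x × ¬ K y × Free y × Close x y)

        go : ∀ m → n ≤ m + card K? → Dec Exit → Σ[ ℛ′ ∈ Reachable w ] Closed (Reachable.K ℛ′)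
        go m fuel (no none) = ℛ , closed
          where
          closed : Closed K
          closed {x} {y} kx x~y with K? y | X? y
          ... | yes ky | _      = inj₁ ky
          ... | no  _  | yes xy = inj₂ xy
          ... | no ¬ky | no ¬xy = contradiction (x , y , kx , ¬ky , ¬xy , x~y) none
        go zero    fuel (yes (x , y , kx , ¬ky , ¬xy , x~y)) =
          contradiction (≤-trans (card-< K? (K? ∪? (y Fin.≟_)) inj₁ ¬ky (inj₂ refl))
                                 (card≤n (K? ∪? (y Fin.≟_)))) (≤⇒≯ fuel)
        go (suc m) fuel (yes (x , y , kx , ¬ky , ¬xy , x~y)) = grow m larger
          (≤-trans fuel (≤-trans (≤-reflexive (sym (+-suc m _)))
            (+-monoʳ-≤ m (card-< K? (K? ∪? (y Fin.≟_)) inj₁ ¬ky (inj₂ refl)))))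
          where
          larger : Reachable w
          larger = record
            { K     = K ∪ (y ≡_)
            ; K?    = K? ∪? (y Fin.≟_)
            ; root  = inj₁ root
            ; reach = λ { (inj₁ kv)   → reach kv
                        ; (inj₂ refl) → let l , ws = reach kx in suc l , snoc ws x~y ¬xy }
            }

    -- T collects closed components that are too small.  By expansion, T stays
    -- small, so that S is not exhausted by T and X.
    largeComponent : ∀ {S : Fin n → Set} (S? : Decidable S) → n ≤ 4 * card S? →
      ∃[ w ] (S w × Free w × Σ[ ℛ ∈ Reachable w ] n ≤ 4 * card (Reachable.K? ℛ))
    largeComponent {S} S? many = sweep n {λ _ → ⊥} (λ _ → no λ ()) (λ ()) empty (m≤m+n n _)
      where
      Found : Set₁
      Found = ∃[ w ] (S w × Free w × Σ[ ℛ ∈ Reachable w ] n ≤ 4 * card (Reachable.K? ℛ))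

      empty : 5 * card {n} {λ _ → ⊥} (λ _ → no λ ()) < n
      empty = subst (_< n) (sym (cong (5 *_) (trans (∑-allFin-const n 0) (*-zeroʳ n)))) n>0

      module _ {T : Fin n → Set} (T? : Decidable T) (T-closed : Closed T) (small : 5 * card T? < n) where

        -- `T` and `X` together have fewer than n/5 + n/20 = n/4 vertices, and `S` has at least n/4.
        -- A strict inequality of indicators then puts `w` in `S` and outside both.
        unexplored : ∃[ w ] (⟦ T? w ⟧ + ⟦ X? w ⟧ < ⟦ S? w ⟧)
        unexplored = ∑-<⇒∃ (allFin n) (*-cancelˡ-< 20 _ _ (begin-strict
          20 * ∑[ w ∈ allFin n ] (⟦ T? w ⟧ + ⟦ X? w ⟧)  ≡⟨ cong (20 *_) (∑-+ (allFin n) _ _) ⟩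
          20 * (card T? + card X?)                      ≡⟨ rearrange (card T?) (card X?) ⟩
          4 * (5 * card T?) + 20 * card X?              <⟨ +-mono-<-≤ (*-monoʳ-< 4 small) few ⟩
          4 * n + n                                     ≡⟨ +-comm (4 * n) n ⟩
          5 * n                                         ≤⟨ *-monoʳ-≤ 5 many ⟩
          5 * (4 * card S?)                             ≡⟨ *-assoc 5 4 (card S?) ⟨
          20 * card S?                                  ∎))
          where
          open ≤-Reasoning
          rearrange : ∀ t x → 20 * (t + x) ≡ 4 * (5 * t) + 20 * x
          rearrange = solve-∀

        new : ∃[ w ] (S w × ¬ T w × Free w)
        new = map₂ (λ {w} → go (S? w) (T? w) (X? w)) unexplored
          where
          go : ∀ {A B C : Set} (A? : Dec A) (B? : Dec B) (C? : Dec C) →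
               ⟦ B? ⟧ + ⟦ C? ⟧ < ⟦ A? ⟧ → A × ¬ B × ¬ C
          go (yes a) (no ¬b) (no ¬c) _        = a , ¬b , ¬c
          go (yes _) (no _)  (yes _) (s≤s ())
          go (yes _) (yes _) _       (s≤s ())

        -- If `T ∪ K` had n/5 vertices, then, since `T`, `K` and `X` cover at most n/2, expansion
        -- would give an edge from `T ∪ K` to the uncovered rest, although edges leave a closed set
        -- only into `X`.
        absorb : ∀ {K : Fin n → Set} (K? : Decidable K) → Closed K → 4 * card K? < n →
                 5 * card (T? ∪? K?) < n
        absorb {K} K? K-closed fewK = ≰⇒> λ manyT∪K →
          let x , y , x∈ , y∉ , x~y = expands (T? ∪? K?) (λ y → ¬? (((T? ∪? K?) ∪? X?) y))
                                        (λ x∈ x∉ → x∉ (inj₁ x∈)) manyT∪K manyRest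
          in y∉ (∪-closed T-closed K-closed x∈ x~y)
          where
          taken? : Decidable ((T ∪ K) ∪ X)
          taken? = (T? ∪? K?) ∪? X?

          card-taken : 2 * card taken? ≤ n
          card-taken = fewer-than-half {card T?} {card K?} {card X?} small fewK few
            (≤-trans (card-∪ (T? ∪? K?) X?) (+-monoˡ-≤ (card X?) (card-∪ T? K?)))

          manyRest : n ≤ 5 * card (¬? ∘ taken?)
          manyRest = begin
            n                                ≤⟨ +-cancelʳ-≤ n n _ doubled ⟩
            2 * card (¬? ∘ taken?)           ≤⟨ *-monoˡ-≤ (card (¬? ∘ taken?)) {2} {5} (s≤s (s≤s z≤n)) ⟩
            5 * card (¬? ∘ taken?)           ∎
            where
            open ≤-Reasoning
            doubled : n + n ≤ 2 * card (¬? ∘ taken?) + n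
            doubled = begin
              n + n                                            ≡⟨ cong (n +_) (+-identityʳ n) ⟨
              2 * n                                            ≤⟨ *-monoʳ-≤ 2 (n≤card+card-∁ taken?) ⟩
              2 * (card taken? + card (¬? ∘ taken?))           ≡⟨ *-distribˡ-+ 2 (card taken?) _ ⟩
              2 * card taken? + 2 * card (¬? ∘ taken?)         ≤⟨ +-monoˡ-≤ _ card-taken ⟩
              n + 2 * card (¬? ∘ taken?)                       ≡⟨ +-comm n _ ⟩
              2 * card (¬? ∘ taken?) + n                       ∎

      -- As for components, `m` bounds the number of vertices outside `T`; each round adds at least
      -- `w`.
      sweep : ∀ m {T : Fin n → Set} (T? : Decidable T) → Closed T → 5 * card T? < n →
              n ≤ m + card T? → Found
      sweep m {T} T? T-closed small fuel = explore m fuel (new T? T-closed small)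
        where
        explore : ∀ m → n ≤ m + card T? → ∃[ w ] (S w × ¬ T w × Free w) → Found
        explore m fuel (w , w∈S , w∉T , free) = go m fuel (component w)
          where
          go : ∀ m → n ≤ m + card T? → Σ[ ℛ ∈ Reachable w ] Closed (Reachable.K ℛ) → Found
          go m fuel (ℛ , K-closed) = decide m fuel (n ≤? 4 * card K?)
            where
            open Reachable ℛ

            decide : ∀ m → n ≤ m + card T? → Dec (n ≤ 4 * card K?) → Found
            decide m       fuel (yes large) = w , w∈S , free , ℛ , large
            decide zero    fuel (no _)      = contradiction (≤-<-trans (m≤n*m (card T?) 5) small) (≤⇒≯ fuel)
            decide (suc m) fuel (no ¬large) = sweep m (T? ∪? K?)
              (∪-closed T-closed K-closed)
              (absorb T? T-closed small K? K-closed (≰⇒> ¬large))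
              (≤-trans fuel (≤-trans (≤-reflexive (sym (+-suc m _)))
                (+-monoʳ-≤ m (card-< T? (T? ∪? K?) inj₁ w∉T (inj₂ root)))))

  module _ {k : ℕ} (below : BelowFraction n k) where

    Threat : (Fin k → Fin n) → Fin n → Set
    Threat C v = ∃[ i ] Close (C i) v

    threat? : ∀ C → Decidable (Threat C)
    threat? C v = Fin.any? λ i → close? (C i) v

    card-threat : ∀ C → card (threat? C) ≤ k * 2235
    card-threat C = begin
      card (threat? C)                               ≤⟨ ∑-mono (allFin n) threat≤ ⟩
      ∑[ v ∈ allFin n ] ∑[ i ∈ allFin k ] W (C i) v  ≡⟨ ∑-swap (allFin n) (allFin k) _ ⟩
      ∑[ i ∈ allFin k ] degree W (C i)               ≤⟨ ∑-bound (allFin k) (λ i → degree≤ (C i)) ⟩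
      length (allFin k) * 2235                       ≡⟨ cong (_* 2235) (length-allFin k) ⟩
      k * 2235                                       ∎
      where
      open ≤-Reasoning
      threat≤ : ∀ v → ⟦ threat? C v ⟧ ≤ ∑[ i ∈ allFin k ] W (C i) v
      threat≤ v = go (threat? C v)
        where
        go : (th : Dec (Threat C v)) → ⟦ th ⟧ ≤ ∑[ i ∈ allFin k ] W (C i) v
        go (no _)            = z≤n
        go (yes (i , close)) = ≤-trans close (∑-∈ (λ i → W (C i) v) (∈-allFin i))

    few-threats : ∀ C → 20 * card (threat? C) ≤ n
    few-threats C = begin
      20 * card (threat? C)      ≡⟨ *-comm 20 (card (threat? C)) ⟩
      card (threat? C) * 20      ≤⟨ *-monoˡ-≤ 20 (card-threat C) ⟩
      k * 2235 * 20              ≡⟨ *-assoc k 2235 20 ⟩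
      -- 2235 * 20 = 44700, against 800 ^ 2 = 640000.
      k * (2235 * 20)            ≤⟨ *-monoʳ-≤ k (≤ᵇ⇒≤ (2235 * 20) (800 ^ 2) tt) ⟩
      k * 800 ^ 2                ≤⟨ <⇒≤ below ⟩
      n                          ∎
      where open ≤-Reasoning

    open module EscapeFrom (C : Fin k → Fin n) = Escape (threat? C) (few-threats C)

    -- It carries a set of vertices and so lies in `Set₁`, which is why `robberEvades` is
    -- polymorphic in the level.
    Good : (Fin k → Fin n) → Fin n → Set₁
    Good C v = ¬ Threat C v × Σ[ ℛ ∈ Reachable C v ] n ≤ 4 * card (Reachable.K? ℛ)

    start : ∀ C → ∃[ v ] Good C v
    start C = map₂ proj₂ (largeComponent C {λ _ → ⊤} (λ _ → yes tt) everything)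
      where
      everything : n ≤ 4 * card {n} {λ _ → ⊤} (λ _ → yes tt)
      everything = ≤-trans (≤-reflexive (sym (trans (∑-allFin-const n 1) (*-identityʳ n)))) (m≤n*m _ 4)

    -- The set reachable past the old threats has at least n/4 vertices, so it can serve as `S` for
    -- the new placement; the vertex found there is reached by a walk of some finite length.
    advance : ∀ {C v} C′ → Good C v → ∃[ w ] (Good C′ w ×
              ∃[ l ] ([ l ] ≤⁺ ⊤⁺ × Walk Close (Unthreatened ⊤⁺ k C) l v w))
    advance {C} {v} C′ (_ , ℛ , large) = follow (largeComponent C′ K? large)
      where
      open Reachable C ℛ

      follow : ∃[ w ] (K w × Good C′ w) → _
      follow (w , w∈K , good) = w , good ,
        map₂ (λ ws → (_ ≤⊤⁺) , walk-map id id (λ free i close → free (i , close)) ws) (reach w∈K)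

    evade : ¬ Game.CopsWin graph ⊤⁺ k
    evade = robberEvades ⊤⁺ k Good (λ (safe , _) i close → safe (i , close)) start advance

theorem1p4 : (R : Speed) → [ 2 ] <⁺ R →
    ∃[ n₀ ] ((n : ℕ) → n₀ ≤ n →
    ((r : ℕ) → R ≡ [ r ] →
    Σ[ G ∈ Graph n ] (Connected G × CopsRequired G R (BelowPower r n)))
    ×
    (R ≡ ⊤⁺ →
    Σ[ G ∈ Graph n ] (Connected G × CopsRequired G R (BelowFraction n))))
-- From `M ^ r` on, the integer root `q` of `n` is at least `M`.
theorem1p4 [ suc (suc (suc t)) ] [ _ ] = FiniteSpeed.M t ^ (3 + t) , λ n n₀≤n →
  (λ { _ refl → FiniteSpeed.hammingGraph t n n₀≤n }) , λ ()
theorem1p4 [ 1 ] [ s≤s () ]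
theorem1p4 [ 2 ] [ s≤s (s≤s ()) ]
-- The expander exists for every `n > 0`, so the threshold is 1.
theorem1p4 ⊤⁺ [ _ ]<⊤⁺ = 1 , λ n n>0 →
  (λ _ ()) , λ _ → let open InfiniteSpeed n>0 (Expander.expander n>0) in
    graph , graph-connected , λ _ → evade
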